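{- Let $G$ be an oriented unicyclic graph on $n\ge 2$ vertices with cycle $C$ and non-zero edge weights in $\mathbb{C}\setminus\mathbb{R}^-$, and let $i,j$ be vertices of $G$. Let $\gamma'_{i\to j}$ and $\gamma_{i\to j}$ be any two walks from vertex $i$ to vertex $j$ in the underlying graph $G_u$. If $wt(C)\in\mathbb{C}\setminus\mathbb{R}^-$, then $$\frac{wt(\gamma'_{i\to j})}{|wt(\gamma'_{i\to j})|}\neq-\frac{wt(\gamma_{i\to j})}{|wt(\gamma_{i\to j})|}.$$
   Context: An oriented graph $G$ is obtained from a finite simple undirected graph $G_u$ (its underlying graph) by giving each edge exactly one direction. It is unicyclic if $G_u$ is connected and has exactly one cycle. Each directed edge $(u,v)$ (from $u$ to $v$) has a non-zero complex weight $w_{uv}$; $\mathbb{R}^-$ denotes the negative real numbers. By convention, walks do not repeat vertices (hence do not repeat edges); that is, a walk from $i$ to $j$ is a path. Put $a_{ij}=w_{ij}$ if $(i,j)\in E(G)$, $a_{ij}=\overline{w_{ji}}$ if $(j,i)\in E(G)$, and $a_{ij}=0$ otherwise. The weight of a walk $\gamma=(i_1,\dots,i_k)$ is $wt(\gamma)=\prod_{s=1}^{k-1}a_{i_si_{s+1}}$ (so a trivial one-vertex walk has weight $1$). $wt(C)$ is the weight (given by the same product) of the closed traversal going once around $C$ in either direction; the two directions give complex conjugate values, so the condition on $wt(C)$ does not depend on the choice. -}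

module Defs where

open import Data.Empty using (⊥-elim)
open import Data.Fin using (Fin)
open import Data.Integer as ℤ using (ℤ; +_)
import Data.Integer.Properties as ℤₚ
open import Data.List using (List; []; _∷_; length)
open import Data.List.Membership.Propositional using (_∈_)
open import Data.List.Relation.Unary.Unique.Propositional using (Unique)
open import Data.Nat as ℕ using (ℕ; zero; suc)
import Data.Nat.Properties as ℕₚ
open import Data.Nat.Solver using () renaming (module +-*-Solver to ℕ-Solver)
open import Data.Product using (∃-syntax; _×_; _,_; proj₁; proj₂)
open import Data.Rational as ℚ using (ℚ; 0ℚ; 1ℚ; ½; mkℚ; ↧ₙ_; ↥_)
import Data.Rational.Properties as ℚₚ
open import Data.Rational.Solver using () renaming (module +-*-Solver to ℚ-Solver)
open import Data.Rational.Unnormalised as ℚᵘ using (mkℚᵘ)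
import Data.Rational.Unnormalised.Properties as ℚᵘₚ
open import Data.Sum using (_⊎_; inj₁; inj₂; [_,_]′)
open import Function using (_⇔_)
open import Level using (0ℓ)
open import Relation.Binary using (Rel; Decidable; Asymmetric)
open import Relation.Binary.Construct.Closure.ReflexiveTransitive using (Star; ε; _◅_; _◅◅_)
open import Relation.Binary.PropositionalEquality using (_≡_; refl; sym; trans; cong; cong₂; subst; subst₂)
open import Relation.Nullary using (¬_; yes; no)

isqrt : ℕ → ℕ
isqrt zero = zero
isqrt (suc m) with suc (isqrt m) ℕ.* suc (isqrt m) ℕ.≤? suc m
... | yes _ = suc (isqrt m)
... | no  _ = isqrt m

isqrt-lower : ∀ m → isqrt m ℕ.* isqrt m ℕ.≤ m
isqrt-lower zero = ℕ.z≤n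
isqrt-lower (suc m) with suc (isqrt m) ℕ.* suc (isqrt m) ℕ.≤? suc m
... | yes p = p
... | no  _ = ℕₚ.m≤n⇒m≤1+n (isqrt-lower m)

isqrt-upper : ∀ m → m ℕ.< suc (isqrt m) ℕ.* suc (isqrt m)
isqrt-upper zero = ℕ.s≤s ℕ.z≤n
isqrt-upper (suc m) with suc (isqrt m) ℕ.* suc (isqrt m) ℕ.≤? suc m
... | yes _ = ℕₚ.≤-<-trans (isqrt-upper m) (ℕₚ.*-mono-< (ℕₚ.n<1+n (suc (isqrt m))) (ℕₚ.n<1+n (suc (isqrt m))))
... | no ¬p = ℕₚ.≰⇒> ¬p

0<* : ∀ {p q} → 0ℚ ℚ.< p → 0ℚ ℚ.< q → 0ℚ ℚ.< p ℚ.* q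
0<* {p} {q} 0<p 0<q = ℚₚ.positive⁻¹ _ {{ℚₚ.pos*pos⇒pos p {{ℚ.positive 0<p}} q {{ℚ.positive 0<q}}}}

0≤* : ∀ {p q} → 0ℚ ℚ.≤ p → 0ℚ ℚ.≤ q → 0ℚ ℚ.≤ p ℚ.* q
0≤* {p} {q} 0≤p 0≤q = ℚₚ.nonNegative⁻¹ _ {{ℚₚ.nonNeg*nonNeg⇒nonNeg p {{ℚ.nonNegative 0≤p}} q {{ℚ.nonNegative 0≤q}}}}

*-mono-≤ : ∀ {p q r s} → 0ℚ ℚ.≤ p → 0ℚ ℚ.≤ r → p ℚ.≤ q → r ℚ.≤ s → p ℚ.* r ℚ.≤ q ℚ.* s
*-mono-≤ {p} {q} {r} {s} 0≤p 0≤r p≤q r≤s = ℚₚ.≤-trans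
  (ℚₚ.*-monoʳ-≤-nonNeg r {{ℚ.nonNegative 0≤r}} p≤q)
  (ℚₚ.*-monoˡ-≤-nonNeg q {{ℚ.nonNegative (ℚₚ.≤-trans 0≤p p≤q)}} r≤s)

0≤² : ∀ p → 0ℚ ℚ.≤ p ℚ.* p
0≤² p with ℚₚ.≤-total 0ℚ p
... | inj₁ 0≤p = 0≤* 0≤p 0≤p
... | inj₂ p≤0 = subst (0ℚ ℚ.≤_)
  (solve 1 (λ x → (:- x) :* (:- x) := x :* x) refl p)
  (0≤* (ℚₚ.neg-antimono-≤ p≤0) (ℚₚ.neg-antimono-≤ p≤0))
  where open ℚ-Solver

≤∣∣ : ∀ p → p ℚ.≤ ℚ.∣ p ∣
≤∣∣ p with ℚₚ.≤-total 0ℚ p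
... | inj₁ 0≤p = ℚₚ.≤-reflexive (sym (ℚₚ.0≤p⇒∣p∣≡p 0≤p))
... | inj₂ p≤0 = ℚₚ.≤-trans p≤0 (ℚₚ.0≤∣p∣ p)

∣∣-swap : ∀ p q → ℚ.∣ p ℚ.- q ∣ ≡ ℚ.∣ q ℚ.- p ∣
∣∣-swap p q = trans (sym (ℚₚ.∣-p∣≡∣p∣ (p ℚ.- q)))
  (cong ℚ.∣_∣ (solve 2 (λ x y → :- (x :- y) := y :- x) refl p q))
  where open ℚ-Solver

∣∣<-intro : ∀ {p q r} → p ℚ.- q ℚ.< r → q ℚ.- p ℚ.< r → ℚ.∣ p ℚ.- q ∣ ℚ.< r
∣∣<-intro {p} {q} {r} h k with ℚₚ.∣p∣≡p∨∣p∣≡-p (p ℚ.- q)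
... | inj₁ e = subst (ℚ._< r) (sym e) h
... | inj₂ e = subst (ℚ._< r) (sym (trans e (solve 2 (λ x y → :- (x :- y) := y :- x) refl p q))) k
  where open ℚ-Solver

half+half : ∀ p → p ℚ.* ½ ℚ.+ p ℚ.* ½ ≡ p
half+half p = trans (sym (ℚₚ.*-distribˡ-+ p ½ ½)) (ℚₚ.*-identityʳ p)

0<½* : ∀ {p} → 0ℚ ℚ.< p → 0ℚ ℚ.< p ℚ.* ½
0<½* h = 0<* h (ℚₚ.positive⁻¹ ½)

shrink : ∀ B δ → 0ℚ ℚ.< B → 0ℚ ℚ.< δ → ∃[ η ] (0ℚ ℚ.< η × B ℚ.* η ≡ δ)
shrink B δ 0<B 0<δ = r ℚ.* δ
  , 0<* (ℚₚ.positive⁻¹ r {{ℚₚ.1/pos⇒pos B {{ℚ.positive 0<B}}}}) 0<δ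
  , trans (sym (ℚₚ.*-assoc B r δ))
      (trans (cong (ℚ._* δ) (ℚₚ.*-inverseʳ B {{ℚₚ.pos⇒nonZero B {{ℚ.positive 0<B}}}})) (ℚₚ.*-identityˡ δ))
  where r = ℚ.1/_ B {{ℚₚ.pos⇒nonZero B {{ℚ.positive 0<B}}}}

1/1+_ : ℕ → ℚ
1/1+ n = + 1 ℚ./ suc n

archimedean : ∀ δ → 0ℚ ℚ.< δ → ∃[ N ] (∀ n → N ℕ.≤ n → 1/1+ n ℚ.≤ δ)
archimedean δ@(mkℚ (+ zero) d _) (ℚ.*<* (ℤ.+<+ ()))
archimedean δ@(mkℚ (+ suc a) d _) _ = d , λ n d≤n → ℚₚ.toℚᵘ-cancel-≤
  (ℚᵘₚ.≤-respˡ-≃ (ℚᵘₚ.≃-sym (ℚₚ.toℚᵘ-fromℚᵘ (mkℚᵘ (+ 1) n)))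
    (ℚᵘ.*≤* (subst₂ ℤ._≤_ (ℤₚ.pos-* 1 (suc d)) (ℤₚ.pos-* (suc a) (suc n))
      (ℤ.+≤+ (ℕₚ.*-mono-≤ {1} {suc a} (ℕ.s≤s ℕ.z≤n) (ℕ.s≤s d≤n))))))
archimedean (mkℚ (ℤ.-[1+ _ ]) _ _) (ℚ.*<* ())

-- The reciprocal, with the convention that the reciprocal of 0 is 0.
recip : ℚ → ℚ
recip q with q ℚₚ.≟ 0ℚ
... | yes _   = 0ℚ
... | no  q≢0 = ℚ.1/_ q {{ℚ.≢-nonZero q≢0}}

recip-inverse : ∀ q → 0ℚ ℚ.< q → q ℚ.* recip q ≡ 1ℚ
recip-inverse q 0<q with q ℚₚ.≟ 0ℚ
... | yes q≡0 = ⊥-elim (ℚₚ.<-irrefl (sym q≡0) 0<q)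
... | no  q≢0 = ℚₚ.*-inverseʳ q {{ℚ.≢-nonZero q≢0}}

-- A rational lower approximation of √∣q∣ with error less than 1/(1+n):
-- √(a/d) = √(a·d·(1+n)²) / (d·(1+n)).
rootℚ : ℕ → ℚ → ℚ
rootℚ n q@record{} = + isqrt (ℤ.∣ ↥ q ∣ ℕ.* ↧ₙ q ℕ.* (suc n ℕ.* suc n)) ℚ./ (↧ₙ q ℕ.* suc n)

rootℚ-nonNeg : ∀ n q → 0ℚ ℚ.≤ rootℚ n q
rootℚ-nonNeg n q@record{} = ℚₚ.nonNegative⁻¹ _
  {{ℚₚ.normalize-nonNeg (isqrt (ℤ.∣ ↥ q ∣ ℕ.* ↧ₙ q ℕ.* (suc n ℕ.* suc n))) (↧ₙ q ℕ.* suc n)}}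

rootℚ-lower : ∀ n q → rootℚ n q ℚ.* rootℚ n q ℚ.≤ ℚ.∣ q ∣
rootℚ-lower n q@(mkℚ z d _) = ℚₚ.toℚᵘ-cancel-≤ (ℚᵘₚ.≤-respˡ-≃ (ℚᵘₚ.≃-sym eq) (ℚᵘ.*≤* ineq))
  where
  a = ℤ.∣ z ∣
  N = suc n
  D = suc d
  k = isqrt (a ℕ.* D ℕ.* (N ℕ.* N))
  rᵘ = mkℚᵘ (+ k) (n ℕ.+ d ℕ.* N)
  eq : ℚ.toℚᵘ (rootℚ n q ℚ.* rootℚ n q) ℚᵘ.≃ rᵘ ℚᵘ.* rᵘ
  eq = ℚᵘₚ.≃-trans (ℚₚ.toℚᵘ-homo-* (rootℚ n q) (rootℚ n q))
    (ℚᵘₚ.*-cong (ℚₚ.toℚᵘ-fromℚᵘ rᵘ) (ℚₚ.toℚᵘ-fromℚᵘ rᵘ))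
  nat : k ℕ.* k ℕ.* D ℕ.≤ a ℕ.* ((D ℕ.* N) ℕ.* (D ℕ.* N))
  nat = ℕₚ.≤-trans (ℕₚ.*-monoˡ-≤ D (isqrt-lower (a ℕ.* D ℕ.* (N ℕ.* N))))
    (ℕₚ.≤-reflexive (solve 3 (λ x y u → x :* y :* (u :* u) :* y := x :* ((y :* u) :* (y :* u))) refl a D N))
    where open ℕ-Solver
  ineq : (+ k ℤ.* + k) ℤ.* + D ℤ.≤ + a ℤ.* + ((D ℕ.* N) ℕ.* (D ℕ.* N))
  ineq = subst₂ ℤ._≤_
    (trans (ℤₚ.pos-* (k ℕ.* k) D) (cong (ℤ._* + D) (ℤₚ.pos-* k k)))
    (ℤₚ.pos-* a _) (ℤ.+≤+ nat)

rootℚ-upper : ∀ n q → ℚ.∣ q ∣ ℚ.< (rootℚ n q ℚ.+ 1/1+ n) ℚ.* (rootℚ n q ℚ.+ 1/1+ n)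
rootℚ-upper n q@(mkℚ z d _) = ℚₚ.toℚᵘ-cancel-< (ℚᵘₚ.<-respʳ-≃ (ℚᵘₚ.≃-sym eq) (ℚᵘ.*<* ineq))
  where
  a = ℤ.∣ z ∣
  N = suc n
  D = suc d
  k = isqrt (a ℕ.* D ℕ.* (N ℕ.* N))
  rᵘ = mkℚᵘ (+ k) (n ℕ.+ d ℕ.* N)
  sᵘ = rᵘ ℚᵘ.+ mkℚᵘ (+ 1) n
  s = rootℚ n q ℚ.+ 1/1+ n
  M = k ℕ.* N ℕ.+ 1 ℕ.* (D ℕ.* N)
  eq₁ : ℚ.toℚᵘ s ℚᵘ.≃ sᵘ
  eq₁ = ℚᵘₚ.≃-trans (ℚₚ.toℚᵘ-homo-+ (rootℚ n q) (1/1+ n))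
    (ℚᵘₚ.+-cong (ℚₚ.toℚᵘ-fromℚᵘ rᵘ) (ℚₚ.toℚᵘ-fromℚᵘ (mkℚᵘ (+ 1) n)))
  eq : ℚ.toℚᵘ (s ℚ.* s) ℚᵘ.≃ sᵘ ℚᵘ.* sᵘ
  eq = ℚᵘₚ.≃-trans (ℚₚ.toℚᵘ-homo-* s s) (ℚᵘₚ.*-cong eq₁ eq₁)
  1+k≤k+D : suc k ℕ.≤ k ℕ.+ D
  1+k≤k+D = subst (ℕ._≤ k ℕ.+ D) (ℕₚ.+-comm k 1) (ℕₚ.+-monoʳ-≤ k (ℕ.s≤s ℕ.z≤n))
  nat : a ℕ.* ((D ℕ.* N ℕ.* N) ℕ.* (D ℕ.* N ℕ.* N)) ℕ.< M ℕ.* M ℕ.* D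
  nat = subst₂ ℕ._<_
    (solve 3 (λ x y u → x :* y :* (u :* u) :* (y :* (u :* u)) := x :* ((y :* u :* u) :* (y :* u :* u))) refl a D N)
    (solve 3 (λ x y u → (x :+ y) :* (x :+ y) :* (y :* (u :* u))
      := (x :* u :+ con 1 :* (y :* u)) :* (x :* u :+ con 1 :* (y :* u)) :* y) refl k D N)
    (ℕₚ.*-monoˡ-< (D ℕ.* (N ℕ.* N))
      (ℕₚ.<-≤-trans (isqrt-upper (a ℕ.* D ℕ.* (N ℕ.* N))) (ℕₚ.*-mono-≤ 1+k≤k+D 1+k≤k+D)))
    where open ℕ-Solver
  numerator : ℚᵘ.↥ sᵘ ≡ + M
  numerator = sym (trans (ℤₚ.pos-+ (k ℕ.* N) (1 ℕ.* (D ℕ.* N)))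
    (cong₂ ℤ._+_ (ℤₚ.pos-* k N) (ℤₚ.pos-* 1 (D ℕ.* N))))
  ineq : + a ℤ.* + ((D ℕ.* N ℕ.* N) ℕ.* (D ℕ.* N ℕ.* N)) ℤ.< (ℚᵘ.↥ sᵘ ℤ.* ℚᵘ.↥ sᵘ) ℤ.* + D
  ineq = subst₂ ℤ._<_ (ℤₚ.pos-* a _)
    (trans (ℤₚ.pos-* (M ℕ.* M) D)
      (cong (ℤ._* + D) (trans (ℤₚ.pos-* M M) (sym (cong₂ ℤ._*_ numerator numerator)))))
    (ℤ.+<+ nat)

Eventually : (ℕ → Set) → Set
Eventually P = ∃[ N ] (∀ n → N ℕ.≤ n → P n)

infixr 4 _⊗_
_⊗_ : ∀ {P Q : ℕ → Set} → Eventually P → Eventually Q → Eventually (λ n → P n × Q n)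
(M , p) ⊗ (N , q) = M ℕ.⊔ N , λ n h →
  p n (ℕₚ.≤-trans (ℕₚ.m≤m⊔n M N) h) , q n (ℕₚ.≤-trans (ℕₚ.m≤n⊔m M N) h)

CauchyAt : ℚ → (ℕ → ℚ) → Set
CauchyAt δ x = ∃[ N ] (∀ m n → N ℕ.≤ m → N ℕ.≤ n → ℚ.∣ x m ℚ.- x n ∣ ℚ.< δ)

Cauchy : (ℕ → ℚ) → Set
Cauchy x = ∀ δ → 0ℚ ℚ.< δ → CauchyAt δ x

-- Real numbers are Cauchy sequences of rationals; their equality is _≈_, not _≡_.
record ℝ : Set where
  constructor mkℝ
  field
    seq    : ℕ → ℚ
    cauchy : Cauchy seq
open ℝ public

infix 4 _≈_ _<_ _#_

_≈_ : ℝ → ℝ → Set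
x ≈ y = ∀ δ → 0ℚ ℚ.< δ → Eventually (λ n → ℚ.∣ seq x n ℚ.- seq y n ∣ ℚ.< δ)

_<_ : ℝ → ℝ → Set
x < y = ∃[ δ ] (0ℚ ℚ.< δ × Eventually (λ n → seq x n ℚ.+ δ ℚ.≤ seq y n))

_#_ : ℝ → ℝ → Set
x # y = x < y ⊎ y < x

fromℚ : ℚ → ℝ
fromℚ q = mkℝ (λ _ → q) λ δ 0<δ → 0 , λ _ _ _ _ →
  subst (ℚ._< δ) (sym (cong ℚ.∣_∣ (ℚₚ.+-inverseʳ q))) 0<δ

0ℝ 1ℝ : ℝ
0ℝ = fromℚ 0ℚ
1ℝ = fromℚ 1ℚ

bounded : (x : ℝ) → ∃[ B ] (0ℚ ℚ.< B × Eventually (λ n → ℚ.∣ seq x n ∣ ℚ.≤ B))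
bounded (mkℝ x c) with c 1ℚ (ℚₚ.positive⁻¹ 1ℚ)
... | N , h = 1ℚ ℚ.+ ℚ.∣ x N ∣
  , ℚₚ.+-mono-<-≤ (ℚₚ.positive⁻¹ 1ℚ) (ℚₚ.0≤∣p∣ (x N))
  , N , λ n N≤n → ℚₚ.≤-trans
    (ℚₚ.≤-reflexive (cong ℚ.∣_∣ (solve 2 (λ a b → a := (a :- b) :+ b) refl (x n) (x N))))
    (ℚₚ.≤-trans (ℚₚ.∣p+q∣≤∣p∣+∣q∣ (x n ℚ.- x N) (x N))
      (ℚₚ.+-monoˡ-≤ ℚ.∣ x N ∣ (ℚₚ.<⇒≤ (h n N N≤n ℕₚ.≤-refl))))
  where open ℚ-Solver

+-cauchy : ∀ {x y} → Cauchy x → Cauchy y → Cauchy (λ n → x n ℚ.+ y n)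
+-cauchy {x} {y} c d δ 0<δ with c (δ ℚ.* ½) (0<½* 0<δ) | d (δ ℚ.* ½) (0<½* 0<δ)
... | M , p | N , q = M ℕ.⊔ N , λ m n hm hn → ℚₚ.≤-<-trans
  (ℚₚ.≤-trans
    (ℚₚ.≤-reflexive (cong ℚ.∣_∣ (solve 4 (λ a b e f → (a :+ b) :- (e :+ f) := (a :- e) :+ (b :- f))
      refl (x m) (y m) (x n) (y n))))
    (ℚₚ.∣p+q∣≤∣p∣+∣q∣ (x m ℚ.- x n) (y m ℚ.- y n)))
  (subst (ℚ.∣ x m ℚ.- x n ∣ ℚ.+ ℚ.∣ y m ℚ.- y n ∣ ℚ.<_) (half+half δ)
    (ℚₚ.+-mono-<
      (p m n (ℕₚ.≤-trans (ℕₚ.m≤m⊔n M N) hm) (ℕₚ.≤-trans (ℕₚ.m≤m⊔n M N) hn))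
      (q m n (ℕₚ.≤-trans (ℕₚ.m≤n⊔m M N) hm) (ℕₚ.≤-trans (ℕₚ.m≤n⊔m M N) hn))))
  where open ℚ-Solver

neg-cauchy : ∀ {x} → Cauchy x → Cauchy (λ n → ℚ.- x n)
neg-cauchy {x} c δ 0<δ with c δ 0<δ
... | N , p = N , λ m n hm hn → subst (ℚ._< δ)
  (trans (∣∣-swap (x m) (x n))
    (cong ℚ.∣_∣ (solve 2 (λ a b → b :- a := (:- a) :- (:- b)) refl (x m) (x n))))
  (p m n hm hn)
  where open ℚ-Solver

*-estimate : ∀ {A η α a b α′ b′} → 0ℚ ℚ.< A → ℚ.∣ b ∣ ℚ.≤ A →
  A ℚ.* η ≡ α → ℚ.∣ α′ ℚ.- a ∣ ℚ.< η → ℚ.∣ b′ ℚ.- b ∣ ℚ.< η →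
  ℚ.∣ α′ ∣ ℚ.≤ A → ℚ.∣ α′ ℚ.* b′ ℚ.- a ℚ.* b ∣ ℚ.< α ℚ.+ α
*-estimate {A} {η} {α} {a} {b} {α′} {b′} 0<A b≤A refl p q α′≤A = ℚₚ.≤-<-trans
  (ℚₚ.≤-trans
    (ℚₚ.≤-reflexive (cong ℚ.∣_∣ (solve 4 (λ s t u v → s :* t :- u :* v := s :* (t :- v) :+ v :* (s :- u))
      refl α′ b′ a b)))
    (ℚₚ.≤-trans (ℚₚ.∣p+q∣≤∣p∣+∣q∣ (α′ ℚ.* (b′ ℚ.- b)) (b ℚ.* (α′ ℚ.- a)))
      (ℚₚ.≤-reflexive (cong₂ ℚ._+_ (ℚₚ.∣p*q∣≡∣p∣*∣q∣ α′ (b′ ℚ.- b)) (ℚₚ.∣p*q∣≡∣p∣*∣q∣ b (α′ ℚ.- a))))))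
  (ℚₚ.+-mono-<
    (bound {α′} {b′ ℚ.- b} α′≤A q) (bound {b} {α′ ℚ.- a} b≤A p))
  where
  open ℚ-Solver
  bound : ∀ {u v} → ℚ.∣ u ∣ ℚ.≤ A → ℚ.∣ v ∣ ℚ.< η → ℚ.∣ u ∣ ℚ.* ℚ.∣ v ∣ ℚ.< A ℚ.* η
  bound {u} {v} h k = ℚₚ.≤-<-trans
    (ℚₚ.*-monoʳ-≤-nonNeg ℚ.∣ v ∣ {{ℚₚ.∣-∣-nonNeg v}} h)
    (ℚₚ.*-monoʳ-<-pos A {{ℚ.positive 0<A}} k)

*-cauchyAt : ∀ {A B η δ} (x y : ℕ → ℚ) → 0ℚ ℚ.< A → 0ℚ ℚ.< B → (A ℚ.+ B) ℚ.* η ≡ δ ℚ.* ½ →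
  Eventually (λ n → ℚ.∣ x n ∣ ℚ.≤ A) → Eventually (λ n → ℚ.∣ y n ∣ ℚ.≤ B) →
  CauchyAt η x → CauchyAt η y → CauchyAt δ (λ n → x n ℚ.* y n)
*-cauchyAt {A} {B} {η} {δ} x y 0<A 0<B eq (L , a) (M , b) (P , p) (Q , q) = K , λ m n hm hn → subst
  (ℚ.∣ x m ℚ.* y m ℚ.- x n ℚ.* y n ∣ ℚ.<_) (half+half δ)
  (*-estimate {A ℚ.+ B} {η} {δ ℚ.* ½} {x n} {y n} {x m} {y m} (ℚₚ.+-mono-< 0<A 0<B) (y≤ n (≥M hn)) eq
    (p m n (≥P hm) (≥P hn)) (q m n (≥Q hm) (≥Q hn)) (x≤ m (≥L hm)))
  where
  K = (L ℕ.⊔ M) ℕ.⊔ (P ℕ.⊔ Q)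
  ≥L : ∀ {n} → K ℕ.≤ n → L ℕ.≤ n
  ≥L h = ℕₚ.≤-trans (ℕₚ.m≤m⊔n L M) (ℕₚ.≤-trans (ℕₚ.m≤m⊔n (L ℕ.⊔ M) (P ℕ.⊔ Q)) h)
  ≥M : ∀ {n} → K ℕ.≤ n → M ℕ.≤ n
  ≥M h = ℕₚ.≤-trans (ℕₚ.m≤n⊔m L M) (ℕₚ.≤-trans (ℕₚ.m≤m⊔n (L ℕ.⊔ M) (P ℕ.⊔ Q)) h)
  ≥P : ∀ {n} → K ℕ.≤ n → P ℕ.≤ n
  ≥P h = ℕₚ.≤-trans (ℕₚ.m≤m⊔n P Q) (ℕₚ.≤-trans (ℕₚ.m≤n⊔m (L ℕ.⊔ M) (P ℕ.⊔ Q)) h)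
  ≥Q : ∀ {n} → K ℕ.≤ n → Q ℕ.≤ n
  ≥Q h = ℕₚ.≤-trans (ℕₚ.m≤n⊔m P Q) (ℕₚ.≤-trans (ℕₚ.m≤n⊔m (L ℕ.⊔ M) (P ℕ.⊔ Q)) h)
  x≤ : ∀ n → L ℕ.≤ n → ℚ.∣ x n ∣ ℚ.≤ A ℚ.+ B
  x≤ n h = ℚₚ.≤-trans (a n h) (subst (ℚ._≤ A ℚ.+ B) (ℚₚ.+-identityʳ A) (ℚₚ.+-monoʳ-≤ A (ℚₚ.<⇒≤ 0<B)))
  y≤ : ∀ n → M ℕ.≤ n → ℚ.∣ y n ∣ ℚ.≤ A ℚ.+ B
  y≤ n h = ℚₚ.≤-trans (b n h) (subst (ℚ._≤ A ℚ.+ B) (ℚₚ.+-identityˡ B) (ℚₚ.+-monoˡ-≤ B (ℚₚ.<⇒≤ 0<A)))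

*-cauchy : (x y : ℝ) → Cauchy (λ n → seq x n ℚ.* seq y n)
*-cauchy x y δ 0<δ = go (bounded x) (bounded y)
  where
  go : ∃[ A ] (0ℚ ℚ.< A × Eventually (λ n → ℚ.∣ seq x n ∣ ℚ.≤ A)) →
       ∃[ B ] (0ℚ ℚ.< B × Eventually (λ n → ℚ.∣ seq y n ∣ ℚ.≤ B)) →
       CauchyAt δ (λ n → seq x n ℚ.* seq y n)
  go (A , 0<A , a) (B , 0<B , b) = go′ (shrink (A ℚ.+ B) (δ ℚ.* ½) (ℚₚ.+-mono-< 0<A 0<B) (0<½* 0<δ))
    where
    go′ : ∃[ η ] (0ℚ ℚ.< η × (A ℚ.+ B) ℚ.* η ≡ δ ℚ.* ½) → CauchyAt δ (λ n → seq x n ℚ.* seq y n)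
    go′ (η , 0<η , eq) = *-cauchyAt {A} {B} {η} {δ} (seq x) (seq y) 0<A 0<B eq a b (cauchy x η 0<η) (cauchy y η 0<η)

recip-cauchy : (x : ℝ) → 0ℝ < x → Cauchy (λ n → recip (seq x n))
recip-cauchy x (ρ , 0<ρ , M , h) δ 0<δ with cauchy x (δ ℚ.* (ρ ℚ.* ρ)) (0<* 0<δ (0<* 0<ρ 0<ρ))
... | N , c = M ℕ.⊔ N , λ m n hm hn →
  step (seq x m) (seq x n)
    (subst (ℚ._≤ seq x m) (ℚₚ.+-identityˡ ρ) (h m (ℕₚ.≤-trans (ℕₚ.m≤m⊔n M N) hm)))
    (subst (ℚ._≤ seq x n) (ℚₚ.+-identityˡ ρ) (h n (ℕₚ.≤-trans (ℕₚ.m≤m⊔n M N) hn)))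
    (c m n (ℕₚ.≤-trans (ℕₚ.m≤n⊔m M N) hm) (ℕₚ.≤-trans (ℕₚ.m≤n⊔m M N) hn))
  where
  open ℚ-Solver
  step : ∀ a b → ρ ℚ.≤ a → ρ ℚ.≤ b → ℚ.∣ a ℚ.- b ∣ ℚ.< δ ℚ.* (ρ ℚ.* ρ) →
    ℚ.∣ recip a ℚ.- recip b ∣ ℚ.< δ
  step a b ρ≤a ρ≤b k = ℚₚ.*-cancelʳ-<-nonNeg (a ℚ.* b) {{ℚ.nonNegative (ℚₚ.<⇒≤ 0<ab)}}
    (ℚₚ.≤-<-trans (ℚₚ.≤-reflexive eq)
      (ℚₚ.<-≤-trans k (ℚₚ.*-monoˡ-≤-nonNeg δ {{ℚ.nonNegative (ℚₚ.<⇒≤ 0<δ)}}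
        (*-mono-≤ (ℚₚ.<⇒≤ 0<ρ) (ℚₚ.<⇒≤ 0<ρ) ρ≤a ρ≤b))))
    where
    0<a = ℚₚ.<-≤-trans 0<ρ ρ≤a
    0<b = ℚₚ.<-≤-trans 0<ρ ρ≤b
    0<ab = 0<* 0<a 0<b
    r = recip a
    s = recip b
    eq : ℚ.∣ r ℚ.- s ∣ ℚ.* (a ℚ.* b) ≡ ℚ.∣ a ℚ.- b ∣
    eq = trans (cong (ℚ.∣ r ℚ.- s ∣ ℚ.*_) (sym (ℚₚ.0≤p⇒∣p∣≡p (ℚₚ.<⇒≤ 0<ab))))
      (trans (sym (ℚₚ.∣p*q∣≡∣p∣*∣q∣ (r ℚ.- s) (a ℚ.* b)))
      (trans (cong ℚ.∣_∣ (solve 4 (λ r s a b → (r :- s) :* (a :* b) := (a :* r) :* b :- (b :* s) :* a) refl r s a b))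
      (trans (cong ℚ.∣_∣ (cong₂ ℚ._-_
          (trans (cong (ℚ._* b) (recip-inverse a 0<a)) (ℚₚ.*-identityˡ b))
          (trans (cong (ℚ._* a) (recip-inverse b 0<b)) (ℚₚ.*-identityˡ a))))
        (∣∣-swap b a))))

∣∣-lipschitz : ∀ p q → ℚ.∣ p ∣ ℚ.- ℚ.∣ q ∣ ℚ.≤ ℚ.∣ p ℚ.- q ∣
∣∣-lipschitz p q = subst (ℚ.∣ p ∣ ℚ.- ℚ.∣ q ∣ ℚ.≤_)
  (solve 2 (λ u v → u :+ v :- v := u) refl ℚ.∣ p ℚ.- q ∣ ℚ.∣ q ∣)
  (ℚₚ.+-monoˡ-≤ (ℚ.- ℚ.∣ q ∣)
    (subst (ℚ._≤ ℚ.∣ p ℚ.- q ∣ ℚ.+ ℚ.∣ q ∣)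
      (cong ℚ.∣_∣ (solve 2 (λ a b → (a :- b) :+ b := a) refl p q))
      (ℚₚ.∣p+q∣≤∣p∣+∣q∣ (p ℚ.- q) q)))
  where open ℚ-Solver

root-gap : ∀ {a b d h X Y} → 0ℚ ℚ.≤ b → 0ℚ ℚ.≤ d → 0ℚ ℚ.< h → d ℚ.≤ h →
  a ℚ.* a ℚ.≤ X → Y ℚ.< (b ℚ.+ d) ℚ.* (b ℚ.+ d) → X ℚ.- Y ℚ.< h ℚ.* h → a ℚ.- b ℚ.< h ℚ.+ h
root-gap {a} {b} {d} {h} {X} {Y} 0≤b 0≤d 0<h d≤h lo up close with a ℚ.- b ℚₚ.<? h ℚ.+ h
... | yes p = p
... | no ¬p = ⊥-elim (ℚₚ.<-irrefl refl (ℚₚ.<-≤-trans close h²≤))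
  where
  open ℚ-Solver
  2h≤a-b : h ℚ.+ h ℚ.≤ a ℚ.- b
  2h≤a-b = ℚₚ.≮⇒≥ ¬p
  t = a ℚ.- b ℚ.- (h ℚ.+ h)
  0≤t : 0ℚ ℚ.≤ t
  0≤t = subst (ℚ._≤ t) (ℚₚ.+-inverseʳ (h ℚ.+ h)) (ℚₚ.+-monoˡ-≤ (ℚ.- (h ℚ.+ h)) 2h≤a-b)
  0≤h = ℚₚ.<⇒≤ 0<h
  c = b ℚ.+ h
  Y≤c² : Y ℚ.≤ c ℚ.* c
  Y≤c² = ℚₚ.≤-trans (ℚₚ.<⇒≤ up)
    (*-mono-≤ (ℚₚ.+-mono-≤ 0≤b 0≤d) (ℚₚ.+-mono-≤ 0≤b 0≤d) (ℚₚ.+-monoʳ-≤ b d≤h) (ℚₚ.+-monoʳ-≤ b d≤h))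
  c+h≤a : c ℚ.+ h ℚ.≤ a
  c+h≤a = subst₂ ℚ._≤_ (ℚₚ.+-identityʳ (c ℚ.+ h))
    (solve 3 (λ a b h → b :+ h :+ h :+ (a :- b :- (h :+ h)) := a) refl a b h)
    (ℚₚ.+-monoʳ-≤ (c ℚ.+ h) 0≤t)
  0≤c : 0ℚ ℚ.≤ c
  0≤c = ℚₚ.+-mono-≤ 0≤b 0≤h
  c²+h²≤X : c ℚ.* c ℚ.+ h ℚ.* h ℚ.≤ X
  c²+h²≤X = ℚₚ.≤-trans
    (subst₂ ℚ._≤_ (ℚₚ.+-identityʳ (c ℚ.* c ℚ.+ h ℚ.* h))
      (solve 2 (λ c h → c :* c :+ h :* h :+ (c :* h :+ c :* h) := (c :+ h) :* (c :+ h)) refl c h)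
      (ℚₚ.+-monoʳ-≤ (c ℚ.* c ℚ.+ h ℚ.* h) (ℚₚ.+-mono-≤ (0≤* 0≤c 0≤h) (0≤* 0≤c 0≤h))))
    (ℚₚ.≤-trans (*-mono-≤ (ℚₚ.+-mono-≤ 0≤c 0≤h) (ℚₚ.+-mono-≤ 0≤c 0≤h) c+h≤a c+h≤a) lo)
  h²≤ : h ℚ.* h ℚ.≤ X ℚ.- Y
  h²≤ = subst (ℚ._≤ X ℚ.- Y)
    (solve 2 (λ c h → c :+ h :- c := h) refl (c ℚ.* c) (h ℚ.* h))
    (ℚₚ.+-mono-≤ c²+h²≤X (ℚₚ.neg-antimono-≤ Y≤c²))

0≤1/1+ : ∀ n → 0ℚ ℚ.≤ 1/1+ n
0≤1/1+ n = ℚₚ.nonNegative⁻¹ _ {{ℚₚ.normalize-nonNeg 1 (suc n)}}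

root-cauchy : ∀ {x} → Cauchy x → Cauchy (λ n → rootℚ n (x n))
root-cauchy {x} c δ 0<δ with c (δ ℚ.* ½ ℚ.* (δ ℚ.* ½)) (0<* (0<½* 0<δ) (0<½* 0<δ)) | archimedean (δ ℚ.* ½) (0<½* 0<δ)
... | M , p | N , q = M ℕ.⊔ N , λ m n hm hn → ∣∣<-intro {rootℚ m (x m)} {rootℚ n (x n)} {δ} (one m n hm hn) (one n m hn hm)
  where
  h = δ ℚ.* ½
  one : ∀ m n → M ℕ.⊔ N ℕ.≤ m → M ℕ.⊔ N ℕ.≤ n → rootℚ m (x m) ℚ.- rootℚ n (x n) ℚ.< δ
  one m n hm hn = subst (rootℚ m (x m) ℚ.- rootℚ n (x n) ℚ.<_) (half+half δ)
    (root-gap {rootℚ m (x m)} {rootℚ n (x n)} {1/1+ n} {h} {ℚ.∣ x m ∣} {ℚ.∣ x n ∣} (rootℚ-nonNeg n (x n)) (0≤1/1+ n) (0<½* 0<δ) (q n (ℕₚ.≤-trans (ℕₚ.m≤n⊔m M N) hn))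
      (rootℚ-lower m (x m)) (rootℚ-upper n (x n))
      (ℚₚ.≤-<-trans (∣∣-lipschitz (x m) (x n))
        (p m n (ℕₚ.≤-trans (ℕₚ.m≤m⊔n M N) hm) (ℕₚ.≤-trans (ℕₚ.m≤m⊔n M N) hn))))

infixl 6 _+_ _-_
infixl 7 _*_
infix  8 -_ √_

_+_ : ℝ → ℝ → ℝ
x + y = mkℝ (λ n → seq x n ℚ.+ seq y n) (+-cauchy {seq x} {seq y} (cauchy x) (cauchy y))

-_ : ℝ → ℝ
- x = mkℝ (λ n → ℚ.- seq x n) (neg-cauchy {seq x} (cauchy x))

_-_ : ℝ → ℝ → ℝ
x - y = x + - y

_*_ : ℝ → ℝ → ℝ
x * y = mkℝ (λ n → seq x n ℚ.* seq y n) (*-cauchy x y)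

inv : (x : ℝ) → 0ℝ < x → ℝ
inv x 0<x = mkℝ (λ n → recip (seq x n)) (recip-cauchy x 0<x)

-- The square root of a non-negative real; for general x this is √∣x∣.
√_ : ℝ → ℝ
√ x = mkℝ (λ n → rootℚ n (seq x n)) (root-cauchy {seq x} (cauchy x))

0<-resp : ∀ {x y} → (∀ n → seq x n ≡ seq y n) → 0ℝ < x → 0ℝ < y
0<-resp e (δ , 0<δ , N , h) = δ , 0<δ , N , λ n N≤n → subst (0ℚ ℚ.+ δ ℚ.≤_) (e n) (h n N≤n)

*-pos : ∀ {x y} → 0ℝ < x → 0ℝ < y → 0ℝ < x * y
*-pos {x} {y} (δ , 0<δ , p) (ρ , 0<ρ , q) = δ ℚ.* ρ , 0<* 0<δ 0<ρ , proj₁ both , λ n h →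
  subst (ℚ._≤ seq x n ℚ.* seq y n) (sym (ℚₚ.+-identityˡ (δ ℚ.* ρ)))
    (*-mono-≤ (ℚₚ.<⇒≤ 0<δ) (ℚₚ.<⇒≤ 0<ρ)
      (subst (ℚ._≤ seq x n) (ℚₚ.+-identityˡ δ) (proj₁ (proj₂ both n h)))
      (subst (ℚ._≤ seq y n) (ℚₚ.+-identityˡ ρ) (proj₂ (proj₂ both n h))))
  where both = p ⊗ q

0<-neg : ∀ {x} → x < 0ℝ → 0ℝ < - x
0<-neg {x} (δ , 0<δ , N , h) = δ , 0<δ , N , λ n N≤n →
  subst₂ ℚ._≤_ (solve 2 (λ a d → (a :+ d) :- a := con 0ℚ :+ d) refl (seq x n) δ)
    (ℚₚ.+-identityˡ (ℚ.- seq x n)) (ℚₚ.+-monoˡ-≤ (ℚ.- seq x n) (h n N≤n))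
  where open ℚ-Solver

²-pos : ∀ {x} → x # 0ℝ → 0ℝ < x * x
²-pos {x} (inj₁ x<0) = 0<-resp {(- x) * (- x)} {x * x}
  (λ n → solve 1 (λ a → (:- a) :* (:- a) := a :* a) refl (seq x n))
  (*-pos { - x} { - x} (0<-neg {x} x<0) (0<-neg {x} x<0))
  where open ℚ-Solver
²-pos {x} (inj₂ 0<x) = *-pos {x} {x} 0<x 0<x

√-pos : ∀ {x} → 0ℝ < x → 0ℝ < √ x
√-pos {x} (δ , 0<δ , p) = h , 0<½* 0<g , proj₁ both , λ n N≤n →
  subst (ℚ._≤ rootℚ n (seq x n)) (sym (ℚₚ.+-identityˡ h))
    (step n (proj₁ (proj₂ both n N≤n)) (proj₂ (proj₂ both n N≤n)))
  where
  g = δ ℚ.⊓ 1ℚ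
  0<g : 0ℚ ℚ.< g
  0<g with ℚₚ.⊓-sel δ 1ℚ
  ... | inj₁ e = subst (0ℚ ℚ.<_) (sym e) 0<δ
  ... | inj₂ e = subst (0ℚ ℚ.<_) (sym e) (ℚₚ.positive⁻¹ 1ℚ)
  h = g ℚ.* ½
  both = p ⊗ archimedean h (0<½* 0<g)
  g²≤δ : g ℚ.* g ℚ.≤ δ
  g²≤δ = subst (g ℚ.* g ℚ.≤_) (ℚₚ.*-identityʳ δ)
    (*-mono-≤ (ℚₚ.<⇒≤ 0<g) (ℚₚ.<⇒≤ 0<g) (ℚₚ.p⊓q≤p δ 1ℚ) (ℚₚ.p⊓q≤q δ 1ℚ))
  step : ∀ n → 0ℚ ℚ.+ δ ℚ.≤ seq x n → 1/1+ n ℚ.≤ h → h ℚ.≤ rootℚ n (seq x n)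
  step n δ≤x d≤h with h ℚₚ.≤? rootℚ n (seq x n)
  ... | yes q = q
  ... | no ¬q = ⊥-elim (ℚₚ.<-irrefl refl (ℚₚ.<-≤-trans (rootℚ-upper n (seq x n))
    (ℚₚ.≤-trans (*-mono-≤ 0≤s 0≤s s≤g s≤g) (ℚₚ.≤-trans g²≤δ
      (ℚₚ.≤-trans (subst (ℚ._≤ seq x n) (ℚₚ.+-identityˡ δ) δ≤x) (≤∣∣ (seq x n)))))))
    where
    s = rootℚ n (seq x n) ℚ.+ 1/1+ n
    0≤s : 0ℚ ℚ.≤ s
    0≤s = ℚₚ.+-mono-≤ (rootℚ-nonNeg n (seq x n)) (0≤1/1+ n)
    s≤g : s ℚ.≤ g
    s≤g = subst (s ℚ.≤_) (half+half g) (ℚₚ.+-mono-≤ (ℚₚ.<⇒≤ (ℚₚ.≰⇒> ¬q)) d≤h)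

record ℂ : Set where
  constructor _+i_
  field
    re : ℝ
    im : ℝ
open ℂ public

infix 4 _≈ℂ_ _#ℂ_

_≈ℂ_ : ℂ → ℂ → Set
z ≈ℂ u = re z ≈ re u × im z ≈ im u

-- Apartness: the constructive form of z ≠ u, needed in order to divide.
_#ℂ_ : ℂ → ℂ → Set
z #ℂ u = re z # re u ⊎ im z # im u

0ℂ 1ℂ : ℂ
0ℂ = 0ℝ +i 0ℝ
1ℂ = 1ℝ +i 0ℝ

infix  8 -ℂ_
infixl 7 _*ℂ_ _÷_[_]

-ℂ_ : ℂ → ℂ
-ℂ z = (- re z) +i (- im z)

conj : ℂ → ℂ
conj z = re z +i (- im z)

_*ℂ_ : ℂ → ℂ → ℂ
z *ℂ u = (re z * re u - im z * im u) +i (re z * im u + im z * re u)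

normSq : ℂ → ℝ
normSq z = re z * re z + im z * im z

∣_∣ : ℂ → ℝ
∣ z ∣ = √ normSq z

-- z ÷ r [ p ] is z / r, for a real r that is positive by p.
_÷_[_] : ℂ → (r : ℝ) → 0ℝ < r → ℂ
z ÷ r [ p ] = (re z * inv r p) +i (im z * inv r p)

ℝ⁻ : ℂ → Set
ℝ⁻ z = re z < 0ℝ × im z ≈ 0ℝ

+²-pos : ∀ {x} y → 0ℝ < x → 0ℝ < x + y * y
+²-pos {x} y (δ , 0<δ , N , h) = δ , 0<δ , N , λ n N≤n → subst (ℚ._≤ seq x n ℚ.+ seq y n ℚ.* seq y n)
  (ℚₚ.+-identityʳ (0ℚ ℚ.+ δ)) (ℚₚ.+-mono-≤ (h n N≤n) (0≤² (seq y n)))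

#0⇒normSq-pos : ∀ z → z #ℂ 0ℂ → 0ℝ < normSq z
#0⇒normSq-pos (x +i y) (inj₁ p) = +²-pos {x * x} y (²-pos {x} p)
#0⇒normSq-pos (x +i y) (inj₂ p) = 0<-resp {y * y + x * x} {x * x + y * y}
  (λ n → ℚₚ.+-comm (seq y n ℚ.* seq y n) (seq x n ℚ.* seq x n))
  (+²-pos {y * y} x (²-pos {y} p))

conj-normSq-pos : ∀ z → 0ℝ < normSq z → 0ℝ < normSq (conj z)
conj-normSq-pos z = 0<-resp {normSq z} {normSq (conj z)} λ n →
  solve 2 (λ a b → a :* a :+ b :* b := a :* a :+ (:- b) :* (:- b)) refl (seq (re z) n) (seq (im z) n)
  where open ℚ-Solver

*-normSq-pos : ∀ z u → 0ℝ < normSq z → 0ℝ < normSq u → 0ℝ < normSq (z *ℂ u)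
*-normSq-pos z u p q = 0<-resp {normSq z * normSq u} {normSq (z *ℂ u)} (λ n →
  solve 4 (λ a b c d → (a :* a :+ b :* b) :* (c :* c :+ d :* d)
    := (a :* c :- b :* d) :* (a :* c :- b :* d) :+ (a :* d :+ b :* c) :* (a :* d :+ b :* c)) refl
    (seq (re z) n) (seq (im z) n) (seq (re u) n) (seq (im u) n))
  (*-pos {normSq z} {normSq u} p q)
  where open ℚ-Solver

1-normSq-pos : 0ℝ < normSq 1ℂ
1-normSq-pos = 1ℚ , ℚₚ.positive⁻¹ 1ℚ , 0 , λ _ _ → ℚₚ.≤-refl

record OrientedGraph (n : ℕ) : Set₁ where
  field
    _⟶_    : Rel (Fin n) 0ℓ
    _⟶?_   : Decidable _⟶_
    -- In particular there are no loops.
    ⟶-asym : Asymmetric _⟶_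

module _ {n : ℕ} (G : OrientedGraph n) where
  open OrientedGraph G

  Adj : Rel (Fin n) 0ℓ
  Adj i j = (i ⟶ j) ⊎ (j ⟶ i)

  vertices : ∀ {i j} → Star Adj i j → List (Fin n)
  vertices {i} ε       = i ∷ []
  vertices {i} (_ ◅ γ) = i ∷ vertices γ

  steps : ∀ {i j} → Star Adj i j → List (Fin n × Fin n)
  steps ε                 = []
  steps (_◅_ {i} {k} _ γ) = (i , k) ∷ steps γ

  -- By convention a walk is a path: no vertex is repeated.
  record Walk (i j : Fin n) : Set where
    field
      route  : Star Adj i j
      simple : Unique (vertices route)

  -- A cycle c₁, …, cₘ (m ≥ 3) given by one of its closed traversals.
  record Cycle : Set where
    field
      {first last} : Fin n
      route        : Star Adj first last
      simple       : Unique (vertices route)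
      long         : 3 ℕ.≤ length (vertices route)
      closing      : Adj last first

    traversal : Star Adj first first
    traversal = route ◅◅ (closing ◅ ε)

  HasEdge : Cycle → Fin n → Fin n → Set
  HasEdge C u v = (u , v) ∈ steps (Cycle.traversal C) ⊎ (v , u) ∈ steps (Cycle.traversal C)

  -- Different traversals of a cycle are identified by having the same
  -- (undirected) edges, i.e. by being the same subgraph.
  SameCycle : Cycle → Cycle → Set
  SameCycle C D = ∀ u v → HasEdge C u v ⇔ HasEdge D u v

  record Unicyclic : Set where
    field
      connected : ∀ i j → Walk i j
      cycle     : Cycle
      unique    : ∀ D → SameCycle D cycle

  -- weight u v is only meaningful when u ⟶ v.
  record Weighting : Set where
    field
      weight  : Fin n → Fin n → ℂ
      nonzero : ∀ {u v} → u ⟶ v → weight u v #ℂ 0ℂ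

  module _ (w : Weighting) where
    open Weighting w

    entry : Fin n → Fin n → ℂ
    entry i j with i ⟶? j | j ⟶? i
    ... | yes _ | _     = weight i j
    ... | no  _ | yes _ = conj (weight j i)
    ... | no  _ | no  _ = 0ℂ

    wt : ∀ {i j} → Star Adj i j → ℂ
    wt ε                 = 1ℂ
    wt (_◅_ {i} {k} _ γ) = entry i k *ℂ wt γ

    entry-pos : ∀ {i j} → Adj i j → 0ℝ < normSq (entry i j)
    entry-pos {i} {j} adj with i ⟶? j | j ⟶? i
    ... | yes p | _     = #0⇒normSq-pos (weight i j) (nonzero p)
    ... | no  _ | yes q = conj-normSq-pos (weight j i) (#0⇒normSq-pos (weight j i) (nonzero q))
    ... | no ¬p | no ¬q = ⊥-elim ([ ¬p , ¬q ]′ adj)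

    wt-normSq-pos : ∀ {i j} (γ : Star Adj i j) → 0ℝ < normSq (wt γ)
    wt-normSq-pos ε = 1-normSq-pos
    wt-normSq-pos (_◅_ {i} {k} e γ) = *-normSq-pos (entry i k) (wt γ) (entry-pos e) (wt-normSq-pos γ)

    ∣wt∣-pos : ∀ {i j} (γ : Star Adj i j) → 0ℝ < ∣ wt γ ∣
    ∣wt∣-pos γ = √-pos {normSq (wt γ)} (wt-normSq-pos γ)

    wt/∣wt∣ : ∀ {i j} → Star Adj i j → ℂ
    wt/∣wt∣ γ = wt γ ÷ ∣ wt γ ∣ [ ∣wt∣-pos γ ]

{-# OPTIONS --safe #-}
-- Work in ℂ modulo multiplication by positive reals: there each edge satisfies a_uv · a_vu = 1, so
-- a route and its reversal are inverse to each other.  If two walks from i to j separate, let them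
-- meet again for the first time; the parts in between form a cycle D, and the remaining parts
-- coincide, as separating again would give a second cycle, one that avoids the first vertex of D.
-- Hence wt γ = wt D · wt γ′.  By uniqueness D is C up to the starting point and the direction, so
-- wt γ / wt γ′ is 1, wt C or (wt C)⁻¹; were it −1, then 1 or wt C would be a negative real.
module Submission where

open import Defs
open import Data.Fin using (Fin)
open import Data.Nat using (ℕ; _≤_)
open import Relation.Nullary using (¬_)

open import Algebra.Bundles using (CommutativeMonoid)
import Algebra.Solver.CommutativeMonoid as CommutativeMonoidSolver
open import Data.Empty using (⊥-elim)
import Data.Fin.Properties as Finₚ
open import Data.List using (List; []; _∷_; [_]; _++_; map; foldr; length)
open import Data.List.Membership.Propositional using (_∈_; _∉_)
open import Data.List.Membership.Propositional.Properties using (∈-++⁺ˡ; ∈-++⁺ʳ; ∈-++⁻; ∈-map⁺)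
open import Data.List.Membership.Propositional.Properties.WithK using (unique∧set⇒bag)
open import Data.List.Properties using (map-++)
open import Data.List.Relation.Binary.BagAndSetEquality using (∼bag⇒↭)
open import Data.List.Relation.Binary.Disjoint.Propositional using (Disjoint)
open import Data.List.Relation.Binary.Permutation.Propositional as Perm using (_↭_)
open import Data.List.Relation.Binary.Subset.Propositional using (_⊆_)
open import Data.List.Relation.Unary.All as All using ([])
open import Data.List.Relation.Unary.Any using (here; there)
open import Data.List.Relation.Unary.Unique.Propositional using (Unique; []; _∷_)
import Data.List.Relation.Unary.Unique.Propositional.Properties as Uniqueₚ
open import Data.Nat using (z≤n; s≤s)
import Data.Nat.Properties as ℕₚ
open import Data.Product as × using (∃-syntax; Σ-syntax; _×_; _,_; proj₁; proj₂)
open import Data.Rational as ℚ using (0ℚ; 1ℚ; ½)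
import Data.Rational.Properties as ℚₚ
open import Data.Rational.Solver using () renaming (module +-*-Solver to ℚ-Solver)
open import Data.Sum as ⊎ using (_⊎_; inj₁; inj₂; [_,_]′)
open import Function using (_∘_; mk⇔; Equivalence)
open import Level using (0ℓ; _⊔_)
open import Relation.Binary.Construct.Closure.ReflexiveTransitive using (Star; ε; _◅_; _◅◅_)
open import Relation.Binary.PropositionalEquality using (_≡_; _≢_; refl; sym; trans; cong; subst; subst₂)
import Relation.Binary.Reasoning.Setoid as ≈-Reasoning
open import Relation.Nullary using (yes; no)

open ℚ-Solver using (solve; _:+_; _:*_; :-_; _:-_; _:=_; con)

-- Routes and cycles

-- Applied with `proj₁` and `proj₂`: when no source (target) repeats, a step is determined by its
-- source (target).
map-injectiveOn : ∀ {A B : Set} {f : A → B} {xs x y} →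
  Unique (map f xs) → x ∈ xs → y ∈ xs → f x ≡ f y → x ≡ y
map-injectiveOn _ (here refl) (here refl) _ = refl
map-injectiveOn {f = f} (p ∷ _) (here refl) (there y∈) e = ⊥-elim (All.lookup p (∈-map⁺ f y∈) e)
map-injectiveOn {f = f} (p ∷ _) (there x∈) (here refl) e = ⊥-elim (All.lookup p (∈-map⁺ f x∈) (sym e))
map-injectiveOn (_ ∷ u) (there x∈) (there y∈) e = map-injectiveOn u x∈ y∈ e

module _ {n : ℕ} (G : OrientedGraph n) where

  private
    V = Fin n
    Route = Star (Adj G)
    open import Data.List.Membership.DecPropositional (Finₚ._≟_ {n}) using (_∈?_)

  targets : ∀ {i j} → Route i j → List V
  targets γ = map proj₂ (steps G γ)

  vertices≡ : ∀ {i j} (γ : Route i j) → vertices G γ ≡ i ∷ targets γ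
  vertices≡ ε = refl
  vertices≡ (_ ◅ γ) = cong (_ ∷_) (vertices≡ γ)

  steps-◅◅ : ∀ {i j k} (γ : Route i j) (δ : Route j k) → steps G (γ ◅◅ δ) ≡ steps G γ ++ steps G δ
  steps-◅◅ ε δ = refl
  steps-◅◅ (_ ◅ γ) δ = cong (_ ∷_) (steps-◅◅ γ δ)

  vertices-◅◅ : ∀ {i j k} (γ : Route i j) (δ : Route j k) → vertices G (γ ◅◅ δ) ≡ vertices G γ ++ targets δ
  vertices-◅◅ ε δ = vertices≡ δ
  vertices-◅◅ (_ ◅ γ) δ = cong (_ ∷_) (vertices-◅◅ γ δ)

  first∈ : ∀ {i j} (γ : Route i j) → i ∈ vertices G γ
  first∈ ε = here refl
  first∈ (_ ◅ _) = here refl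

  last∈ : ∀ {i j} (γ : Route i j) → j ∈ vertices G γ
  last∈ ε = here refl
  last∈ (_ ◅ γ) = there (last∈ γ)

  targets⊆vertices : ∀ {i j} (γ : Route i j) → targets γ ⊆ vertices G γ
  targets⊆vertices γ p = subst (_ ∈_) (sym (vertices≡ γ)) (there p)

  source∈ : ∀ {i j u v} (γ : Route i j) → (u , v) ∈ steps G γ → u ∈ vertices G γ
  source∈ (_ ◅ γ) (here refl) = here refl
  source∈ (_ ◅ γ) (there p) = there (source∈ γ p)

  target∈ : ∀ {i j u v} (γ : Route i j) → (u , v) ∈ steps G γ → v ∈ vertices G γ
  target∈ γ p = targets⊆vertices γ (∈-map⁺ proj₂ p)

  simple-loop : ∀ {i} (γ : Route i i) → Unique (vertices G γ) → length (vertices G γ) ≡ 1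
  simple-loop ε _ = refl
  simple-loop (_ ◅ γ) (p ∷ _) = ⊥-elim (All.lookup p (last∈ γ) refl)

  2≤length : ∀ {i j} (γ : Route i j) → i ≢ j → 2 ≤ length (vertices G γ)
  2≤length ε i≢i = ⊥-elim (i≢i refl)
  2≤length (_ ◅ ε) _ = s≤s (s≤s z≤n)
  2≤length (_ ◅ (_ ◅ _)) _ = s≤s (s≤s z≤n)

  ◅◅-suffix-⊆ : ∀ {i j k} (γ : Route i j) (δ : Route j k) → vertices G δ ⊆ vertices G (γ ◅◅ δ)
  ◅◅-suffix-⊆ ε δ p = p
  ◅◅-suffix-⊆ (_ ◅ γ) δ p = there (◅◅-suffix-⊆ γ δ p)

  ◅◅-prefix-⊆ : ∀ {i j k} (γ : Route i j) (δ : Route j k) → vertices G γ ⊆ vertices G (γ ◅◅ δ)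
  ◅◅-prefix-⊆ γ δ p = subst (_ ∈_) (sym (vertices-◅◅ γ δ)) (∈-++⁺ˡ p)

  ◅◅-suffix-unique : ∀ {i j k} (γ : Route i j) (δ : Route j k) →
    Unique (vertices G (γ ◅◅ δ)) → Unique (vertices G δ)
  ◅◅-suffix-unique ε δ u = u
  ◅◅-suffix-unique (_ ◅ γ) δ (_ ∷ u) = ◅◅-suffix-unique γ δ u

  ◅◅-prefix-unique : ∀ {i j k} (γ : Route i j) (δ : Route j k) →
    Unique (vertices G (γ ◅◅ δ)) → Unique (vertices G γ)
  ◅◅-prefix-unique ε δ _ = [] ∷ []
  ◅◅-prefix-unique (_ ◅ γ) δ (p ∷ u) =
    All.tabulate (λ q → All.lookup p (◅◅-prefix-⊆ γ δ q)) ∷ ◅◅-prefix-unique γ δ u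

  split : ∀ {i j v} (γ : Route i j) → v ∈ vertices G γ →
    Σ[ α ∈ Route i v ] Σ[ β ∈ Route v j ] α ◅◅ β ≡ γ
  split ε (here refl) = ε , ε , refl
  split γ@(_ ◅ _) (here refl) = ε , γ , refl
  split (e ◅ γ) (there p) with split γ p
  ... | α , β , refl = e ◅ α , β , refl

  -- Reversal is excluded anywhere in the route, not just for consecutive steps; this is what
  -- comparing the step sets of two traversals relies on.
  NoBacktrack : ∀ {i j} → Route i j → Set
  NoBacktrack γ = ∀ {u v} → (u , v) ∈ steps G γ → (v , u) ∉ steps G γ

  -- The first vertex never recurs, so it is not the target of a later step, as reversing the first
  -- step would require.
  simple⇒noBacktrack : ∀ {i j} (γ : Route i j) → Unique (vertices G γ) → NoBacktrack γ
  simple⇒noBacktrack (_ ◅ γ) (p ∷ _) (here refl) (here refl) = All.lookup p (first∈ γ) refl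
  simple⇒noBacktrack (_ ◅ γ) (p ∷ _) (here refl) (there q) = All.lookup p (target∈ γ q) refl
  simple⇒noBacktrack (_ ◅ γ) (p ∷ _) (there q) (here refl) = All.lookup p (target∈ γ q) refl
  simple⇒noBacktrack (_ ◅ γ) (_ ∷ u) (there q) (there r) = simple⇒noBacktrack γ u q r

  -- Since `i` does not recur, such a step would be the first one; what follows it is a simple route
  -- from `j` to `j`, hence trivial, leaving only two vertices.
  first⟶last∉ : ∀ {i j} (γ : Route i j) →
    Unique (vertices G γ) → 3 ≤ length (vertices G γ) → (i , j) ∉ steps G γ
  first⟶last∉ (_ ◅ γ) (_ ∷ u) (s≤s l) (here refl) with subst (2 ≤_) (simple-loop γ u) l
  ... | s≤s ()
  first⟶last∉ (_ ◅ γ) (p ∷ _) _ (there q) = All.lookup p (source∈ γ q) refl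

  -- Traversals of a cycle

  module _ (C : Cycle G) where
    open Cycle C

    traversal-steps : steps G traversal ≡ steps G route ++ [ (last , first) ]
    traversal-steps = steps-◅◅ route (closing ◅ ε)

    -- The traversal returns to `first`, so its own vertex list has a repetition; the sources list
    -- every vertex of the cycle once.
    traversal-sources : map proj₁ (steps G traversal) ≡ vertices G route
    traversal-sources = go route
      where
      go : ∀ {i} (γ : Route i last) → map proj₁ (steps G (γ ◅◅ (closing ◅ ε))) ≡ vertices G γ
      go ε = refl
      go (_ ◅ γ) = cong (_ ∷_) (go γ)

    traversal-targets : targets traversal ≡ targets route ++ [ first ]
    traversal-targets = trans (cong (map proj₂) traversal-steps) (map-++ proj₂ (steps G route) _)

    sources-unique : Unique (map proj₁ (steps G traversal))
    sources-unique = subst Unique (sym traversal-sources) simple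

    targets-unique : Unique (targets traversal)
    targets-unique with subst Unique (vertices≡ route) simple
    ... | p ∷ u = subst Unique (sym traversal-targets)
      (Uniqueₚ.++⁺ u ([] ∷ []) λ { (q , here refl) → All.lookup p q refl })

    traversal-noBacktrack : NoBacktrack traversal
    traversal-noBacktrack p q
      with ∈-++⁻ (steps G route) (subst (_ ∈_) traversal-steps p)
         | ∈-++⁻ (steps G route) (subst (_ ∈_) traversal-steps q)
    ... | inj₁ p | inj₁ q = simple⇒noBacktrack route simple p q
    ... | inj₁ p | inj₂ (here refl) = first⟶last∉ route simple long p
    ... | inj₂ (here refl) | inj₁ q = first⟶last∉ route simple long q
    -- If both are the closing step, `first` and `last` coincide and the simple route has a single
    -- vertex, against `long`; `loop` abstracts the endpoints so that their equality can be matched.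
    ... | inj₂ (here refl) | inj₂ (here e) with subst (3 ≤_) (loop route simple (cong proj₁ e)) long
      where
      loop : ∀ {i j} (γ : Route i j) → Unique (vertices G γ) → i ≡ j → length (vertices G γ) ≡ 1
      loop γ u refl = simple-loop γ u
    ... | s≤s ()

    hasEdge⇒vertex : ∀ {u v} → HasEdge G C u v → u ∈ vertices G route
    hasEdge⇒vertex (inj₁ p) = subst (_ ∈_) traversal-sources (∈-map⁺ proj₁ p)
    hasEdge⇒vertex (inj₂ p) with ∈-++⁻ (targets route) (subst (_ ∈_) traversal-targets (∈-map⁺ proj₂ p))
    ... | inj₁ q = targets⊆vertices route q
    ... | inj₂ (here refl) = first∈ route

  -- A change of direction would make C enter (or leave) the same vertex twice.
  coherent : (C : Cycle G) → let T = steps G (Cycle.traversal C) in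
    ∀ {i j} (γ : Route i j) → NoBacktrack γ → (∀ {u v} → (u , v) ∈ steps G γ → HasEdge G C u v) →
    steps G γ ⊆ T ⊎ map ×.swap (steps G γ) ⊆ T
  coherent C ε _ _ = inj₁ λ ()
  coherent C (e ◅ ε) _ h with h (here refl)
  ... | inj₁ p = inj₁ λ { (here refl) → p }
  ... | inj₂ p = inj₂ λ { (here refl) → p }
  coherent C (e ◅ (f ◅ γ)) nb h
    with h (here refl) | coherent C (f ◅ γ) (λ p q → nb (there p) (there q)) (λ p → h (there p))
  ... | inj₁ p | inj₁ q = inj₁ λ { (here refl) → p ; (there r) → q r }
  ... | inj₂ p | inj₂ q = inj₂ λ { (here refl) → p ; (there r) → q r }
  ... | inj₁ p | inj₂ q with map-injectiveOn (targets-unique C) p (q (here refl)) refl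
  ...   | refl = ⊥-elim (nb (here refl) (there (here refl)))
  coherent C (e ◅ (f ◅ γ)) nb h | inj₂ p | inj₁ q with map-injectiveOn (sources-unique C) p (q (here refl)) refl
  ...   | refl = ⊥-elim (nb (here refl) (there (here refl)))

  -- By `coherent` the steps of `D` all run with `C` or all against it. The converse inclusion comes
  -- from the shared edges, as one met in the wrong direction would make `C` backtrack. The
  -- permutation absorbs the change of starting point.
  sameCycle⇒↭ : ∀ (D C : Cycle G) → SameCycle G D C →
    let S = steps G (Cycle.traversal D) ; T = steps G (Cycle.traversal C) in
    S ↭ T ⊎ map ×.swap S ↭ T
  sameCycle⇒↭ D C same = go (coherent C (Cycle.traversal D) (traversal-noBacktrack D)
      (λ p → Equivalence.to (same _ _) (inj₁ p)))
    where
    S = steps G (Cycle.traversal D)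
    T = steps G (Cycle.traversal C)
    uS : Unique S
    uS = Uniqueₚ.map⁻ (sources-unique D)
    uT : Unique T
    uT = Uniqueₚ.map⁻ (sources-unique C)
    back : ∀ {u v} → (u , v) ∈ T → (u , v) ∈ S ⊎ (v , u) ∈ S
    back p = Equivalence.from (same _ _) (inj₁ p)
    unique↭ : ∀ {xs ys : List (V × V)} → Unique xs → Unique ys → xs ⊆ ys → ys ⊆ xs → xs ↭ ys
    unique↭ u v p q = ∼bag⇒↭ (unique∧set⇒bag u v (mk⇔ p q))
    go : S ⊆ T ⊎ map ×.swap S ⊆ T → S ↭ T ⊎ map ×.swap S ↭ T
    go (inj₁ S⊆T) = inj₁ (unique↭ uS uT S⊆T λ p →
      [ (λ q → q) , (λ q → ⊥-elim (traversal-noBacktrack C p (S⊆T q))) ]′ (back p))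
    go (inj₂ S⊆T) = inj₂ (unique↭ (Uniqueₚ.map⁺ (λ { refl → refl }) uS) uT S⊆T λ p →
      [ (λ q → ⊥-elim (traversal-noBacktrack C p (S⊆T (∈-map⁺ ×.swap q)))) , ∈-map⁺ ×.swap ]′ (back p))

  -- Products over steps in a commutative monoid

  InvertedByReversal : ∀ {c ℓ} (M : CommutativeMonoid c ℓ) → (V → V → CommutativeMonoid.Carrier M) → Set ℓ
  InvertedByReversal M φ = ∀ {u v} → Adj G u v → φ u v ∙ φ v u ≋ 1#
    where open CommutativeMonoid M using (_∙_) renaming (ε to 1#; _≈_ to _≋_)

  module _ {c ℓ} (M : CommutativeMonoid c ℓ) (φ : V → V → CommutativeMonoid.Carrier M)
    (φ-inverse : InvertedByReversal M φ) where

    open CommutativeMonoid M using (Carrier; _∙_; ∙-cong; ∙-congˡ; ∙-congʳ; assoc; comm; identityˡ; reflexive)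
      renaming (ε to 1#; _≈_ to _≋_)
    open CommutativeMonoidSolver M using (_⊕_; _⊜_; id) renaming (solve to solveᴹ)
    private
      module Eq = CommutativeMonoid M

    -- Defined on lists of pairs, so that it also applies to permuted and swapped lists, which need
    -- not be the steps of a route.
    Φ : List (V × V) → Carrier
    Φ = foldr (λ (u , v) → φ u v ∙_) 1#

    Φ-++ : ∀ xs ys → Φ (xs ++ ys) ≋ Φ xs ∙ Φ ys
    Φ-++ [] ys = Eq.sym (identityˡ _)
    Φ-++ ((u , v) ∷ xs) ys = Eq.trans (∙-congˡ (Φ-++ xs ys)) (Eq.sym (assoc (φ u v) (Φ xs) (Φ ys)))

    Φ-◅◅ : ∀ {i j k} (γ : Route i j) (δ : Route j k) →
      Φ (steps G (γ ◅◅ δ)) ≋ Φ (steps G γ) ∙ Φ (steps G δ)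
    Φ-◅◅ γ δ = Eq.trans (reflexive (cong Φ (steps-◅◅ γ δ))) (Φ-++ (steps G γ) (steps G δ))

    Φ-↭ : ∀ {xs ys} → xs ↭ ys → Φ xs ≋ Φ ys
    Φ-↭ Perm.refl = Eq.refl
    Φ-↭ (Perm.prep _ p) = ∙-congˡ (Φ-↭ p)
    Φ-↭ {_ ∷ _ ∷ xs} {_ ∷ _ ∷ ys} (Perm.swap (a , b) (c , d) p) = Eq.trans (∙-congˡ (∙-congˡ (Φ-↭ p)))
      (solveᴹ 3 (λ x y z → x ⊕ (y ⊕ z) ⊜ y ⊕ (x ⊕ z)) Eq.refl (φ a b) (φ c d) (Φ ys))
    Φ-↭ (Perm.trans p q) = Eq.trans (Φ-↭ p) (Φ-↭ q)

    -- By commutativity the swapped steps, in unchanged order, stand for the reversed route; each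
    -- edge cancels against its reversal.
    Φ-swap : ∀ {i j} (γ : Route i j) → Φ (steps G γ) ∙ Φ (map ×.swap (steps G γ)) ≋ 1#
    Φ-swap ε = identityˡ 1#
    Φ-swap (_◅_ {i} {k} e γ) = Eq.trans
      (solveᴹ 4 (λ x x′ y y′ → (x ⊕ y) ⊕ (x′ ⊕ y′) ⊜ (x ⊕ x′) ⊕ (y ⊕ y′)) Eq.refl
        (φ i k) (φ k i) (Φ (steps G γ)) (Φ (map ×.swap (steps G γ))))
      (Eq.trans (∙-cong (φ-inverse e) (Φ-swap γ)) (identityˡ 1#))

    sameCycle⇒Φ : ∀ (D C : Cycle G) → SameCycle G D C →
      let S = steps G (Cycle.traversal D) ; T = steps G (Cycle.traversal C) in
      Φ S ≋ Φ T ⊎ Φ S ∙ Φ T ≋ 1#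
    sameCycle⇒Φ D C same = ⊎.map Φ-↭
      (λ p → Eq.trans (∙-congˡ (Eq.sym (Φ-↭ p))) (Φ-swap (Cycle.traversal D))) (sameCycle⇒↭ D C same)

    -- Separating walks and the cycle between them

    -- γ′ is followed up to its first vertex on β, where rest begins; the part passed by then is
    -- reversed and put in front of R, giving back.
    record Meeting {k j x k′ : V} (β : Route k j) (γ′ : Route x j) (R : Route x k′) : Set ℓ where
      field
        {meet}   : V
        rest     : Route meet j
        back     : Route meet k′
        meet∈    : meet ∈ vertices G β
        rest⊆    : vertices G rest ⊆ vertices G γ′
        restU    : Unique (vertices G rest)
        backU    : Unique (vertices G back)
        disjoint : Disjoint (targets back) (vertices G β)
        back⊆    : ∀ {v} → v ∈ vertices G back → v ∈ vertices G γ′ ⊎ v ∈ vertices G R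
        balance  : Φ (steps G back) ∙ Φ (steps G γ′) ≋ Φ (steps G rest) ∙ Φ (steps G R)

    stop : ∀ {k j x k′} {β : Route k j} (γ′ : Route x j) (R : Route x k′) → x ∈ vertices G β →
      Unique (vertices G γ′) → Unique (vertices G R) → Disjoint (targets R) (vertices G β) → Meeting β γ′ R
    stop γ′ R x∈ u v d = record
      { rest = γ′ ; back = R ; meet∈ = x∈ ; rest⊆ = λ p → p ; restU = u ; backU = v
      ; disjoint = d ; back⊆ = inj₂ ; balance = comm _ _ }

    -- Recursion on `γ′`: while its first vertex is off `β`, its first step moves, reversed, to the
    -- front of `R`. This ends at `j` at the latest, which lies on `β`. The last hypothesis keeps
    -- `R` simple as it grows.
    meeting : ∀ {k j x k′} (β : Route k j) (γ′ : Route x j) (R : Route x k′) →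
      Unique (vertices G γ′) → Unique (vertices G R) → Disjoint (targets R) (vertices G β) →
      Disjoint (vertices G R) (targets γ′) → Meeting β γ′ R
    meeting β ε R u v d _ = stop ε R (last∈ β) u v d
    meeting {x = x} β γ′@(_◅_ {j = y} e δ) R (p ∷ u) v d d′ with x ∈? vertices G β
    ... | yes x∈ = stop γ′ R x∈ (p ∷ u) v d
    ... | no x∉ = record
      { Meeting m hiding (rest⊆; back⊆; balance)
      ; rest⊆ = there ∘ rest⊆
      ; back⊆ = λ q → [ inj₁ ∘ there ,
          (λ { (here refl) → inj₁ (there (first∈ δ)) ; (there r) → inj₂ r }) ]′ (back⊆ q)
      -- Multiplying the recursive balance by `φ x y` cancels the factor `φ y x` of the step that
      -- went into `R`.
      ; balance = Eq.trans
          (solveᴹ 3 (λ b s t → b ⊕ (s ⊕ t) ⊜ s ⊕ (b ⊕ t)) Eq.refl (Φ (steps G back)) (φ x y) (Φ (steps G δ)))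
          (Eq.trans (∙-congˡ balance)
          (Eq.trans (solveᴹ 4 (λ s s′ t r → s ⊕ (t ⊕ (s′ ⊕ r)) ⊜ (s ⊕ s′) ⊕ (t ⊕ r)) Eq.refl
            (φ x y) (φ y x) (Φ (steps G rest)) (Φ (steps G R)))
          (Eq.trans (∙-congʳ (φ-inverse e)) (identityˡ _))))
      }
      where
      m = meeting β δ (⊎.swap e ◅ R) u
        (All.tabulate (λ q y≡ → d′ (q , here (sym y≡))) ∷ v)
        (λ { (q , r) → [ (λ { refl → x∉ r }) , (λ q → d (q , r)) ]′ (uncons q) })
        (λ { (here refl , q) → Uniqueₚ.Unique[x∷xs]⇒x∉xs (subst Unique (vertices≡ δ) u) q
           ; (there q , r) → d′ (q , there r) })
        where
        uncons : ∀ {v} → v ∈ map proj₂ (steps G (⊎.swap e ◅ R)) → v ≡ x ⊎ v ∈ targets R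
        uncons (here e) = inj₁ e
        uncons (there q) = inj₂ q
      open Meeting m

    -- The walks separate at `first` of `cycle` and come together at `meet`. The cycle follows `γ`
    -- to `meet` and returns against `γ′`, so its product exchanges that part of `γ′` for that of
    -- `γ`; `common` is the product along `γ` up to `meet`, any shared beginning included.
    record Branching {i j : V} (γ′ γ : Route i j) : Set (c ⊔ ℓ) where
      field
        cycle    : Cycle G
        common   : Carrier
        {meet}   : V
        rest′    : Route meet j
        rest     : Route meet j
        rest′U   : Unique (vertices G rest′)
        restU    : Unique (vertices G rest)
        first∉′  : Cycle.first cycle ∉ vertices G rest′
        first∉   : Cycle.first cycle ∉ vertices G rest
        cycle⊆   : ∀ {v} → v ∈ vertices G (Cycle.route cycle) → v ∈ vertices G γ′ ⊎ v ∈ vertices G γ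
        weight′  : Φ (steps G (Cycle.traversal cycle)) ∙ Φ (steps G γ′) ≋ common ∙ Φ (steps G rest′)
        weight   : Φ (steps G γ) ≋ common ∙ Φ (steps G rest)

    -- The cycle leaves `i` by `e`, follows `β` to the vertex where `β′` first hits it, runs back
    -- along `β′` to `k′` and closes with `e′` reversed. It is simple because `β′` avoids `β` before
    -- that vertex.
    branch : ∀ {i j k′ k} (e′ : Adj G i k′) (e : Adj G i k) (β′ : Route k′ j) (β : Route k j) →
      Unique (vertices G (e′ ◅ β′)) → Unique (vertices G (e ◅ β)) → k ≢ k′ → Branching (e′ ◅ β′) (e ◅ β)
    branch {i} {j} {k′} {k} e′ e β′ β (p′ ∷ u′) (p ∷ u) k≢k′ = go (split β meet∈)
      where
      m : Meeting β β′ ε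
      m = meeting β β′ ε u′ ([] ∷ []) (λ ())
        (λ { (here refl , q) → Uniqueₚ.Unique[x∷xs]⇒x∉xs (subst Unique (vertices≡ β′) u′) q })
      open Meeting m
      go : Σ[ α ∈ Route k meet ] Σ[ δ ∈ Route meet j ] α ◅◅ δ ≡ β → Branching (e′ ◅ β′) (e ◅ β)
      go (α , δ , α◅◅δ≡β) = record
        { cycle = D
        ; common = φ i k ∙ Φ (steps G α)
        ; rest′ = rest
        ; rest = δ
        ; rest′U = restU
        ; restU = ◅◅-suffix-unique α δ u₂
        -- `first` of `D` is `i`, which the simple walks visit only at the start.
        ; first∉′ = λ q → All.lookup p′ (rest⊆ q) refl
        ; first∉ = λ q → All.lookup p (subst (λ β → _ ∈ vertices G β) α◅◅δ≡β (◅◅-suffix-⊆ α δ q)) refl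
        ; cycle⊆ = λ { (here refl) → inj₁ (here refl) ; (there q) → ⊎.map there there (ρ⊆ q) }
        -- The closing factor `φ k′ i` cancels the factor `φ i k′` of `e′`, and `balance`, with `R`
        -- trivial, turns `back` and `β′` into `rest`.
        ; weight′ = Eq.trans
            (∙-congʳ (∙-congˡ (Eq.trans (Φ-◅◅ ρ (⊎.swap e′ ◅ ε)) (∙-congʳ (Φ-◅◅ α back)))))
            (Eq.trans (solveᴹ 6 (λ s a b t t′ r →
                (s ⊕ ((a ⊕ b) ⊕ (t′ ⊕ id))) ⊕ (t ⊕ r) ⊜ (t ⊕ t′) ⊕ ((s ⊕ a) ⊕ (b ⊕ r))) Eq.refl
              (φ i k) (Φ (steps G α)) (Φ (steps G back)) (φ i k′) (φ k′ i) (Φ (steps G β′)))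
            (Eq.trans (∙-cong (φ-inverse e′) (∙-congˡ balance))
            (solveᴹ 2 (λ a b → id ⊕ (a ⊕ (b ⊕ id)) ⊜ a ⊕ b) Eq.refl (φ i k ∙ Φ (steps G α)) (Φ (steps G rest)))))
        ; weight = Eq.trans
            (∙-congˡ (Eq.trans (reflexive (cong (Φ ∘ steps G) (sym α◅◅δ≡β))) (Φ-◅◅ α δ)))
            (Eq.sym (assoc _ _ _))
        }
        where
        u₂ : Unique (vertices G (α ◅◅ δ))
        u₂ = subst (Unique ∘ vertices G) (sym α◅◅δ≡β) u
        α⊆β : vertices G α ⊆ vertices G β
        α⊆β q = subst (λ β → _ ∈ vertices G β) α◅◅δ≡β (◅◅-prefix-⊆ α δ q)
        ρ : Route k k′
        ρ = α ◅◅ back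
        ρ⊆ : ∀ {v} → v ∈ vertices G ρ → v ∈ vertices G β′ ⊎ v ∈ vertices G β
        ρ⊆ q with ∈-++⁻ (vertices G α) (subst (_ ∈_) (vertices-◅◅ α back) q)
        ... | inj₁ r = inj₂ (α⊆β r)
        ... | inj₂ r with back⊆ (targets⊆vertices back r)
        ...   | inj₁ s = inj₁ s
        ...   | inj₂ (here refl) = inj₁ (first∈ β′)
        i∉ρ : i ∉ vertices G ρ
        i∉ρ q = [ (λ r → All.lookup p′ r refl) , (λ r → All.lookup p r refl) ]′ (ρ⊆ q)
        targets-back-unique : Unique (targets back)
        targets-back-unique with subst Unique (vertices≡ back) backU
        ... | _ ∷ v = v
        ρU : Unique (vertices G ρ)
        ρU = subst Unique (sym (vertices-◅◅ α back))
          (Uniqueₚ.++⁺ (◅◅-prefix-unique α δ u₂) targets-back-unique λ (q , r) → disjoint (r , α⊆β q))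
        D : Cycle G
        D = record
          { route = e ◅ ρ
          ; simple = All.tabulate (λ { q refl → i∉ρ q }) ∷ ρU
          -- `ρ` joins the distinct vertices `k` and `k′`, which gives two vertices besides `i`.
          ; long = s≤s (2≤length ρ k≢k′)
          ; closing = ⊎.swap e′
          }

    -- Common first steps are stripped until the walks differ. Comparing vertices suffices, as `φ`
    -- does not see which adjacency proof a step carries. If just one walk has ended, the other
    -- would return to its own start.
    compare : ∀ {i j} (γ′ γ : Route i j) → Unique (vertices G γ′) → Unique (vertices G γ) →
      Φ (steps G γ′) ≋ Φ (steps G γ) ⊎ Branching γ′ γ
    compare ε ε _ _ = inj₁ Eq.refl
    compare ε (_ ◅ γ) _ (p ∷ _) = ⊥-elim (All.lookup p (last∈ γ) refl)
    compare (_ ◅ γ′) ε (p ∷ _) _ = ⊥-elim (All.lookup p (last∈ γ′) refl)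
    compare (_◅_ {i} {k′} e′ γ′) (_◅_ {j = k} e γ) u′@(_ ∷ v′) u@(_ ∷ v) with k Finₚ.≟ k′
    ... | no k≢k′ = inj₂ (branch e′ e γ′ γ u′ u k≢k′)
    ... | yes refl = ⊎.map ∙-congˡ extend (compare γ′ γ v′ v)
      where
      extend : Branching γ′ γ → Branching (e′ ◅ γ′) (e ◅ γ)
      extend b = record
        { Branching b hiding (common; cycle⊆; weight′; weight)
        ; common = φ i k ∙ common
        ; cycle⊆ = ⊎.map there there ∘ cycle⊆
        ; weight′ = Eq.trans
            (solveᴹ 3 (λ c s t → c ⊕ (s ⊕ t) ⊜ s ⊕ (c ⊕ t)) Eq.refl
              (Φ (steps G (Cycle.traversal cycle))) (φ i k) (Φ (steps G γ′)))
            (Eq.trans (∙-congˡ weight′) (Eq.sym (assoc _ _ _)))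
        ; weight = Eq.trans (∙-congˡ weight) (Eq.sym (assoc _ _ _))
        }
        where open Branching b

    -- Two walks in a unicyclic graph

    module _ (uni : Unicyclic G) where
      open Unicyclic uni renaming (cycle to C)

      -- By uniqueness both cycles have the same edges, so the second passes through `first` of the
      -- first cycle; but its vertices lie on `rest′` and `rest`, which avoid it.
      single-branching : ∀ {i j} {γ′ γ : Route i j} (b : Branching γ′ γ) →
        ¬ Branching (Branching.rest′ b) (Branching.rest b)
      single-branching b b₂ = [ first∉′ , first∉ ]′
        (Branching.cycle⊆ b₂ (hasEdge⇒vertex (Branching.cycle b₂) shared))
        where
        open Branching b
        open Cycle cycle using (first; last; route)
        -- The closing edge, named from `first` to `last` because `hasEdge⇒vertex` yields the first
        -- entry.
        shared : HasEdge G (Branching.cycle b₂) first last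
        shared = Equivalence.from (unique (Branching.cycle b₂) _ _) (Equivalence.to (unique cycle _ _)
          (inj₂ (subst (_ ∈_) (sym (traversal-steps cycle)) (∈-++⁺ʳ (steps G route) (here refl)))))

      -- After a branching the rests contribute equally, so `y ∙ x′ ≋ x` for the product `y` along
      -- its cycle; depending on the direction, `y` is `z` or an inverse of `z`.
      Φ-walks : ∀ {i j} (γ′ γ : Walk G i j) →
        let x′ = Φ (steps G (Walk.route γ′)) ; x = Φ (steps G (Walk.route γ)) ; z = Φ (steps G (Cycle.traversal C)) in
        x′ ≋ x ⊎ z ∙ x′ ≋ x ⊎ z ∙ x ≋ x′
      Φ-walks γ′ γ with compare (Walk.route γ′) (Walk.route γ) (Walk.simple γ′) (Walk.simple γ)
      ... | inj₁ e = inj₁ e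
      ... | inj₂ b with compare (Branching.rest′ b) (Branching.rest b) (Branching.rest′U b) (Branching.restU b)
      ...   | inj₂ b₂ = ⊥-elim (single-branching b b₂)
      ...   | inj₁ e = inj₂ ([ (λ f → inj₁ (Eq.trans (∙-congʳ (Eq.sym f)) y∙x′≈x)) , (λ f → inj₂ (inverse f)) ]′
                (sameCycle⇒Φ cycle C (unique cycle)))
        where
        open Branching b
        x′ = Φ (steps G (Walk.route γ′))
        x = Φ (steps G (Walk.route γ))
        y = Φ (steps G (Cycle.traversal cycle))
        z = Φ (steps G (Cycle.traversal C))
        y∙x′≈x : y ∙ x′ ≋ x
        y∙x′≈x = Eq.trans weight′ (Eq.trans (∙-congˡ e) (Eq.sym weight))
        inverse : y ∙ z ≋ 1# → z ∙ x ≋ x′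
        inverse f = Eq.trans (∙-congˡ (Eq.sym y∙x′≈x))
          (Eq.trans (solveᴹ 3 (λ z y x → z ⊕ (y ⊕ x) ⊜ (y ⊕ z) ⊕ x) Eq.refl z y x′)
          (Eq.trans (∙-congʳ f) (identityˡ x′)))

      -- Transfers the result to weights given by their own recursion along the route, such as `wt`.
      multiplicative-walks : (W : ∀ {i j} → Route i j → Carrier) →
        (∀ {i} → W {i} ε ≋ 1#) → (∀ {i k j} (e : Adj G i k) (γ : Route k j) → W (e ◅ γ) ≋ φ i k ∙ W γ) →
        ∀ {i j} (γ′ γ : Walk G i j) →
        let x′ = W (Walk.route γ′) ; x = W (Walk.route γ) ; z = W (Cycle.traversal C) in
        x′ ≋ x ⊎ z ∙ x′ ≋ x ⊎ z ∙ x ≋ x′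
      multiplicative-walks W W-ε W-◅ γ′ γ = ⊎.map
        (λ h → Eq.trans W′ (Eq.trans h (Eq.sym W₀)))
        (⊎.map
          (λ h → Eq.trans (∙-cong Wᶜ W′) (Eq.trans h (Eq.sym W₀)))
          (λ h → Eq.trans (∙-cong Wᶜ W₀) (Eq.trans h (Eq.sym W′))))
        (Φ-walks γ′ γ)
        where
        W≈Φ : ∀ {i j} (γ : Route i j) → W γ ≋ Φ (steps G γ)
        W≈Φ ε = W-ε
        W≈Φ (e ◅ γ) = Eq.trans (W-◅ e γ) (∙-congˡ (W≈Φ γ))
        W′ = W≈Φ (Walk.route γ′)
        W₀ = W≈Φ (Walk.route γ)
        Wᶜ = W≈Φ (Cycle.traversal C)

-- Real and complex numbers

eventually : ∀ {P Q : ℕ → Set} → (∀ n → P n → Q n) → Eventually P → Eventually Q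
eventually f (N , p) = N , λ n h → f n (p n h)

eventually-≡⇒≈ : ∀ {x y} → Eventually (λ n → seq x n ≡ seq y n) → x ≈ y
eventually-≡⇒≈ {x} {y} e δ 0<δ = eventually (λ n q → subst (ℚ._< δ)
  (sym (trans (cong (λ a → ℚ.∣ a ℚ.- seq y n ∣) q) (cong ℚ.∣_∣ (ℚₚ.+-inverseʳ (seq y n))))) 0<δ) e

pointwise⇒≈ : ∀ {x y} → (∀ n → seq x n ≡ seq y n) → x ≈ y
pointwise⇒≈ {x} {y} e = eventually-≡⇒≈ {x} {y} (0 , λ n _ → e n)

≈-refl : ∀ {x} → x ≈ x
≈-refl {x} = pointwise⇒≈ {x} {x} λ _ → refl

≈-sym : ∀ {x y} → x ≈ y → y ≈ x
≈-sym {x} {y} h δ 0<δ = eventually (λ n → subst (ℚ._< δ) (∣∣-swap (seq x n) (seq y n))) (h δ 0<δ)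

∣+∣<halves : ∀ {p q δ} → ℚ.∣ p ∣ ℚ.< δ ℚ.* ½ → ℚ.∣ q ∣ ℚ.< δ ℚ.* ½ → ℚ.∣ p ℚ.+ q ∣ ℚ.< δ
∣+∣<halves {p} {q} {δ} h k = ℚₚ.≤-<-trans (ℚₚ.∣p+q∣≤∣p∣+∣q∣ p q)
  (subst (ℚ.∣ p ∣ ℚ.+ ℚ.∣ q ∣ ℚ.<_) (half+half δ) (ℚₚ.+-mono-< h k))

≈-trans : ∀ {x y z} → x ≈ y → y ≈ z → x ≈ z
≈-trans {x} {y} {z} h k δ 0<δ = eventually
  (λ n (p , q) → subst (λ a → ℚ.∣ a ∣ ℚ.< δ)
    (solve 3 (λ a b c → (a :- b) :+ (b :- c) := a :- c) refl (seq x n) (seq y n) (seq z n))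
    (∣+∣<halves {seq x n ℚ.- seq y n} {seq y n ℚ.- seq z n} {δ} p q))
  (h (δ ℚ.* ½) (0<½* {δ} 0<δ) ⊗ k (δ ℚ.* ½) (0<½* {δ} 0<δ))

+-cong : ∀ {x x′ y y′} → x ≈ x′ → y ≈ y′ → x + y ≈ x′ + y′
+-cong {x} {x′} {y} {y′} h k δ 0<δ = eventually
  (λ n (p , q) → subst (λ a → ℚ.∣ a ∣ ℚ.< δ)
    (solve 4 (λ a b c d → (a :- b) :+ (c :- d) := (a :+ c) :- (b :+ d)) refl (seq x n) (seq x′ n) (seq y n) (seq y′ n))
    (∣+∣<halves {seq x n ℚ.- seq x′ n} {seq y n ℚ.- seq y′ n} {δ} p q))
  (h (δ ℚ.* ½) (0<½* {δ} 0<δ) ⊗ k (δ ℚ.* ½) (0<½* {δ} 0<δ))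

neg-cong : ∀ {x y} → x ≈ y → - x ≈ - y
neg-cong {x} {y} h δ 0<δ = eventually
  (λ n p → subst (ℚ._< δ) (trans (∣∣-swap (seq x n) (seq y n))
    (cong ℚ.∣_∣ (solve 2 (λ a b → b :- a := (:- a) :- (:- b)) refl (seq x n) (seq y n)))) p)
  (h δ 0<δ)

*-cong : ∀ {x x′ y y′} → x ≈ x′ → y ≈ y′ → x * y ≈ x′ * y′
-- The difference splits as x(y - y′) + y′(x - x′), so `x` and `y′` are the factors to be bounded.
*-cong {x} {x′} {y} {y′} h k δ 0<δ = go (bounded x) (bounded y′)
  where
  Goal = Eventually (λ n → ℚ.∣ seq x n ℚ.* seq y n ℚ.- seq x′ n ℚ.* seq y′ n ∣ ℚ.< δ)
  go : ∃[ A ] (0ℚ ℚ.< A × Eventually (λ n → ℚ.∣ seq x n ∣ ℚ.≤ A)) →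
       ∃[ B ] (0ℚ ℚ.< B × Eventually (λ n → ℚ.∣ seq y′ n ∣ ℚ.≤ B)) → Goal
  go (A , 0<A , a) (B , 0<B , b) = go′ (shrink (A ℚ.+ B) (δ ℚ.* ½) 0<A+B (0<½* {δ} 0<δ))
    where
    0<A+B = ℚₚ.+-mono-< 0<A 0<B
    x≤ : ∀ n → ℚ.∣ seq x n ∣ ℚ.≤ A → ℚ.∣ seq x n ∣ ℚ.≤ A ℚ.+ B
    x≤ n r = ℚₚ.≤-trans r (subst (ℚ._≤ A ℚ.+ B) (ℚₚ.+-identityʳ A) (ℚₚ.+-monoʳ-≤ A (ℚₚ.<⇒≤ 0<B)))
    y≤ : ∀ n → ℚ.∣ seq y′ n ∣ ℚ.≤ B → ℚ.∣ seq y′ n ∣ ℚ.≤ A ℚ.+ B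
    y≤ n r = ℚₚ.≤-trans r (subst (ℚ._≤ A ℚ.+ B) (ℚₚ.+-identityˡ B) (ℚₚ.+-monoˡ-≤ B (ℚₚ.<⇒≤ 0<A)))
    go′ : ∃[ η ] (0ℚ ℚ.< η × (A ℚ.+ B) ℚ.* η ≡ δ ℚ.* ½) → Goal
    go′ (η , 0<η , eq) = eventually
      (λ n ((p , q) , (r , s)) → subst (ℚ.∣ seq x n ℚ.* seq y n ℚ.- seq x′ n ℚ.* seq y′ n ∣ ℚ.<_) (half+half δ)
        (*-estimate {A ℚ.+ B} {η} {δ ℚ.* ½} {seq x′ n} {seq y′ n} {seq x n} {seq y n} 0<A+B
          (y≤ n s) eq p q (x≤ n r)))
      ((h η 0<η ⊗ k η 0<η) ⊗ (a ⊗ b))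

0<⇒eventually : ∀ {x} → 0ℝ < x → Eventually (λ n → 0ℚ ℚ.< seq x n)
0<⇒eventually {x} (δ , 0<δ , h) = eventually
  (λ n p → ℚₚ.<-≤-trans 0<δ (subst (ℚ._≤ seq x n) (ℚₚ.+-identityˡ δ) p)) h

-- The equation holds termwise from the index on where the terms are positive.
inv-inverse : ∀ x (p : 0ℝ < x) → x * inv x p ≈ 1ℝ
inv-inverse x p = eventually-≡⇒≈ {x * inv x p} {1ℝ}
  (eventually (λ n → recip-inverse (seq x n)) (0<⇒eventually {x} p))

recip-pos : ∀ {p} → 0ℚ ℚ.< p → 0ℚ ℚ.< recip p
recip-pos {p} 0<p = ℚₚ.*-cancelˡ-<-nonNeg p {{ℚ.nonNegative (ℚₚ.<⇒≤ 0<p)}}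
  (subst₂ ℚ._<_ (sym (ℚₚ.*-zeroʳ p)) (sym (recip-inverse p 0<p)) (ℚₚ.positive⁻¹ 1ℚ))

-- Multiply `p ≤ q` by the product of both reciprocals and cancel.
recip-anti : ∀ {p q} → 0ℚ ℚ.< p → p ℚ.≤ q → recip q ℚ.≤ recip p
recip-anti {p} {q} 0<p p≤q = subst₂ ℚ._≤_
  (trans (solve 3 (λ p r s → s :* (p :* r) := (p :* r) :* s) refl p (recip p) (recip q))
    (trans (cong (ℚ._* recip q) (recip-inverse p 0<p)) (ℚₚ.*-identityˡ (recip q))))
  (trans (solve 3 (λ q r s → s :* (q :* r) := (q :* s) :* r) refl q (recip p) (recip q))
    (trans (cong (ℚ._* recip p) (recip-inverse q 0<q)) (ℚₚ.*-identityˡ (recip p))))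
  (*-mono-≤ (ℚₚ.<⇒≤ (recip-pos 0<q)) (0≤* (ℚₚ.<⇒≤ 0<p) (ℚₚ.<⇒≤ (recip-pos 0<p))) ℚₚ.≤-refl
    (*-mono-≤ (ℚₚ.<⇒≤ 0<p) (ℚₚ.<⇒≤ (recip-pos 0<p)) p≤q ℚₚ.≤-refl))
  where 0<q = ℚₚ.<-≤-trans 0<p p≤q

inv-pos : ∀ x (p : 0ℝ < x) → 0ℝ < inv x p
inv-pos x p = go (bounded x)
  where
  go : ∃[ B ] (0ℚ ℚ.< B × Eventually (λ n → ℚ.∣ seq x n ∣ ℚ.≤ B)) → 0ℝ < inv x p
  -- An eventual upper bound `B` on `x` gives the uniform positive gap `recip B` below its
  -- reciprocals.
  go (B , 0<B , b) = recip B , recip-pos {B} 0<B , eventually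
    (λ n (0<x , x≤B) → subst (ℚ._≤ recip (seq x n)) (sym (ℚₚ.+-identityˡ (recip B)))
      (recip-anti {seq x n} {B} 0<x (ℚₚ.≤-trans (≤∣∣ (seq x n)) x≤B)))
    (0<⇒eventually {x} p ⊗ b)

-- Half of the gap of `y` above 0 pays for the approximation error; the other half remains as the
-- gap of `x` below 0.
≈-neg-pos⇒<0 : ∀ {x y} → x ≈ - y → 0ℝ < y → x < 0ℝ
≈-neg-pos⇒<0 {x} {y} h (δ , 0<δ , k) = η , 0<½* {δ} 0<δ , eventually
  (λ n (p , q) → bound (seq x n) (seq y n) p (subst (ℚ._≤ seq y n) (ℚₚ.+-identityˡ δ) q))
  (h η (0<½* {δ} 0<δ) ⊗ k)
  where
  η = δ ℚ.* ½
  bound : ∀ a b → ℚ.∣ a ℚ.- (ℚ.- b) ∣ ℚ.< η → δ ℚ.≤ b → a ℚ.+ η ℚ.≤ 0ℚ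
  bound a b p q = ℚₚ.≤-trans (subst₂ ℚ._≤_
    (solve 3 (λ a b d → (a :- (:- b)) :+ (d :- b) := a :+ d) refl a b η)
    (trans (solve 2 (λ d b → d :+ (d :- b) := (d :+ d) :- b) refl η b)
      (cong (ℚ._- b) (half+half δ)))
    (ℚₚ.+-monoˡ-≤ (η ℚ.- b) (ℚₚ.≤-trans (≤∣∣ (a ℚ.- (ℚ.- b))) (ℚₚ.<⇒≤ p))))
    (subst (δ ℚ.- b ℚ.≤_) (ℚₚ.+-inverseʳ b) (ℚₚ.+-monoˡ-≤ (ℚ.- b) q))

≈ℂ-refl : ∀ {z} → z ≈ℂ z
≈ℂ-refl {z} = ≈-refl {re z} , ≈-refl {im z}

≈ℂ-sym : ∀ {z u} → z ≈ℂ u → u ≈ℂ z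
≈ℂ-sym {z} {u} (p , q) = ≈-sym {re z} {re u} p , ≈-sym {im z} {im u} q

≈ℂ-trans : ∀ {z u v} → z ≈ℂ u → u ≈ℂ v → z ≈ℂ v
≈ℂ-trans {z} {u} {v} (p , q) (p′ , q′) = ≈-trans {re z} {re u} {re v} p p′ , ≈-trans {im z} {im u} {im v} q q′

*ℂ-cong : ∀ {z z′ u u′} → z ≈ℂ z′ → u ≈ℂ u′ → z *ℂ u ≈ℂ z′ *ℂ u′
*ℂ-cong {a +i b} {a′ +i b′} {c +i d} {c′ +i d′} (p , q) (r , s) =
    +-cong {a * c} {a′ * c′} { - (b * d)} { - (b′ * d′)} (*-cong {a} {a′} {c} {c′} p r)
      (neg-cong {b * d} {b′ * d′} (*-cong {b} {b′} {d} {d′} q s))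
  , +-cong {a * d} {a′ * d′} {b * c} {b′ * c′} (*-cong {a} {a′} {d} {d′} p s) (*-cong {b} {b′} {c} {c′} q r)

pointwise⇒≈ℂ : ∀ {z u} → (∀ n → seq (re z) n ≡ seq (re u) n) → (∀ n → seq (im z) n ≡ seq (im u) n) → z ≈ℂ u
pointwise⇒≈ℂ {z} {u} p q = pointwise⇒≈ {re z} {re u} p , pointwise⇒≈ {im z} {im u} q

infixr 8 _•_
_•_ : ℝ → ℂ → ℂ
r • z = (r * re z) +i (r * im z)

•-congˡ : ∀ r {z u} → z ≈ℂ u → r • z ≈ℂ r • u
•-congˡ r {z} {u} (p , q) = *-cong {r} {r} {re z} {re u} (≈-refl {r}) p , *-cong {r} {r} {im z} {im u} (≈-refl {r}) q

•-assoc : ∀ r s z → (r * s) • z ≈ℂ r • (s • z)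
•-assoc r s z = pointwise⇒≈ℂ {(r * s) • z} {r • (s • z)}
  (λ n → ℚₚ.*-assoc (seq r n) (seq s n) (seq (re z) n)) (λ n → ℚₚ.*-assoc (seq r n) (seq s n) (seq (im z) n))

•-swap : ∀ r s z → r • (s • z) ≈ℂ s • (r • z)
•-swap r s z = pointwise⇒≈ℂ {r • (s • z)} {s • (r • z)} (λ n → swap (re z) n) (λ n → swap (im z) n)
  where
  swap : ∀ x n → seq r n ℚ.* (seq s n ℚ.* seq x n) ≡ seq s n ℚ.* (seq r n ℚ.* seq x n)
  swap x n = solve 3 (λ r s x → r :* (s :* x) := s :* (r :* x)) refl (seq r n) (seq s n) (seq x n)

•-*ℂ : ∀ r s z u → (r * s) • (z *ℂ u) ≈ℂ (r • z) *ℂ (s • u)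
•-*ℂ r s (a +i b) (c +i d) = pointwise⇒≈ℂ {(r * s) • ((a +i b) *ℂ (c +i d))} {(r • (a +i b)) *ℂ (s • (c +i d))}
  (λ n → solve 6 (λ r s a b c d → (r :* s) :* (a :* c :+ :- (b :* d)) := (r :* a) :* (s :* c) :+ :- ((r :* b) :* (s :* d))) refl
    (seq r n) (seq s n) (seq a n) (seq b n) (seq c n) (seq d n))
  (λ n → solve 6 (λ r s a b c d → (r :* s) :* (a :* d :+ b :* c) := (r :* a) :* (s :* d) :+ (r :* b) :* (s :* c)) refl
    (seq r n) (seq s n) (seq a n) (seq b n) (seq c n) (seq d n))

-- Complex numbers modulo positive real factors

infix 4 _∼_

-- Positive factors on both sides make symmetry a swap and transitivity a multiplication, without
-- division.
_∼_ : ℂ → ℂ → Set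
z ∼ u = ∃[ r ] ∃[ s ] (0ℝ < r × 0ℝ < s × r • z ≈ℂ s • u)

0<1 : 0ℝ < 1ℝ
0<1 = 1ℚ , ℚₚ.positive⁻¹ 1ℚ , 0 , λ _ _ → ℚₚ.≤-refl

≈ℂ⇒∼ : ∀ {z u} → z ≈ℂ u → z ∼ u
≈ℂ⇒∼ {z} {u} p = 1ℝ , 1ℝ , 0<1 , 0<1 , •-congˡ 1ℝ {z} {u} p

∼-sym : ∀ {z u} → z ∼ u → u ∼ z
∼-sym {z} {u} (r , s , 0<r , 0<s , p) = s , r , 0<s , 0<r , ≈ℂ-sym {r • z} {s • u} p

-- Scaling the two equations by `r′` and `s` gives them the same middle term.
∼-trans : ∀ {z u v} → z ∼ u → u ∼ v → z ∼ v
∼-trans {z} {u} {v} (r , s , 0<r , 0<s , p) (r′ , s′ , 0<r′ , 0<s′ , p′) =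
  r′ * r , s * s′ , *-pos {r′} {r} 0<r′ 0<r , *-pos {s} {s′} 0<s 0<s′ ,
  ≈ℂ-trans {(r′ * r) • z} {r′ • (r • z)} {(s * s′) • v} (•-assoc r′ r z)
  (≈ℂ-trans {r′ • (r • z)} {r′ • (s • u)} {(s * s′) • v} (•-congˡ r′ {r • z} {s • u} p)
  (≈ℂ-trans {r′ • (s • u)} {s • (r′ • u)} {(s * s′) • v} (•-swap r′ s u)
  (≈ℂ-trans {s • (r′ • u)} {s • (s′ • v)} {(s * s′) • v} (•-congˡ s {r′ • u} {s′ • v} p′)
  (≈ℂ-sym {(s * s′) • v} {s • (s′ • v)} (•-assoc s s′ v)))))

*ℂ-∼-cong : ∀ {z z′ u u′} → z ∼ z′ → u ∼ u′ → z *ℂ u ∼ z′ *ℂ u′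
*ℂ-∼-cong {z} {z′} {u} {u′} (r , s , 0<r , 0<s , p) (r′ , s′ , 0<r′ , 0<s′ , p′) =
  r * r′ , s * s′ , *-pos {r} {r′} 0<r 0<r′ , *-pos {s} {s′} 0<s 0<s′ ,
  ≈ℂ-trans {(r * r′) • (z *ℂ u)} {(r • z) *ℂ (r′ • u)} {(s * s′) • (z′ *ℂ u′)} (•-*ℂ r r′ z u)
  (≈ℂ-trans {(r • z) *ℂ (r′ • u)} {(s • z′) *ℂ (s′ • u′)} {(s * s′) • (z′ *ℂ u′)}
    (*ℂ-cong {r • z} {s • z′} {r′ • u} {s′ • u′} p p′)
  (≈ℂ-sym {(s * s′) • (z′ *ℂ u′)} {(s • z′) *ℂ (s′ • u′)} (•-*ℂ s s′ z′ u′)))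

*ℂ-assoc : ∀ z u v → (z *ℂ u) *ℂ v ≈ℂ z *ℂ (u *ℂ v)
*ℂ-assoc z@(a +i b) u@(c +i d) v@(e +i f) = pointwise⇒≈ℂ {(z *ℂ u) *ℂ v} {z *ℂ (u *ℂ v)}
  (λ n → solve 6 (λ a b c d e f →
      (a :* c :+ :- (b :* d)) :* e :+ :- ((a :* d :+ b :* c) :* f)
      := a :* (c :* e :+ :- (d :* f)) :+ :- (b :* (c :* f :+ d :* e))) refl
    (seq a n) (seq b n) (seq c n) (seq d n) (seq e n) (seq f n))
  (λ n → solve 6 (λ a b c d e f →
      (a :* c :+ :- (b :* d)) :* f :+ (a :* d :+ b :* c) :* e
      := a :* (c :* f :+ d :* e) :+ b :* (c :* e :+ :- (d :* f))) refl
    (seq a n) (seq b n) (seq c n) (seq d n) (seq e n) (seq f n))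

*ℂ-comm : ∀ z u → z *ℂ u ≈ℂ u *ℂ z
*ℂ-comm z@(a +i b) u@(c +i d) = pointwise⇒≈ℂ {z *ℂ u} {u *ℂ z}
  (λ n → solve 4 (λ a b c d → a :* c :+ :- (b :* d) := c :* a :+ :- (d :* b)) refl (seq a n) (seq b n) (seq c n) (seq d n))
  (λ n → solve 4 (λ a b c d → a :* d :+ b :* c := c :* b :+ d :* a) refl (seq a n) (seq b n) (seq c n) (seq d n))

*ℂ-identityˡ : ∀ z → 1ℂ *ℂ z ≈ℂ z
*ℂ-identityˡ z@(a +i b) = pointwise⇒≈ℂ {1ℂ *ℂ z} {z}
  (λ n → solve 2 (λ a b → con 1ℚ :* a :+ :- (con 0ℚ :* b) := a) refl (seq a n) (seq b n))
  (λ n → solve 2 (λ a b → con 1ℚ :* b :+ con 0ℚ :* a := b) refl (seq a n) (seq b n))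

-- Zero stays in the carrier, so this is only a monoid; conjugates supply the inverses that the
-- argument requires.
ℂ/ℝ⁺ : CommutativeMonoid 0ℓ 0ℓ
ℂ/ℝ⁺ = record
  { Carrier = ℂ
  ; _≈_ = _∼_
  ; _∙_ = _*ℂ_
  ; ε = 1ℂ
  ; isCommutativeMonoid = record
    { isMonoid = record
      { isSemigroup = record
        { isMagma = record
          { isEquivalence = record
            { refl = λ {z} → ≈ℂ⇒∼ {z} {z} (≈ℂ-refl {z})
            ; sym = λ {z} {u} → ∼-sym {z} {u}
            ; trans = λ {z} {u} {v} → ∼-trans {z} {u} {v}
            }
          ; ∙-cong = λ {z} {z′} {u} {u′} → *ℂ-∼-cong {z} {z′} {u} {u′}
          }
        ; assoc = λ z u v → ≈ℂ⇒∼ {(z *ℂ u) *ℂ v} {z *ℂ (u *ℂ v)} (*ℂ-assoc z u v)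
        }
      ; identity = identityˡ , λ z → ∼-trans {z *ℂ 1ℂ} {1ℂ *ℂ z} {z} (comm z 1ℂ) (identityˡ z)
      }
    ; comm = comm
    }
  }
  where
  identityˡ : ∀ z → 1ℂ *ℂ z ∼ z
  identityˡ z = ≈ℂ⇒∼ {1ℂ *ℂ z} {z} (*ℂ-identityˡ z)
  comm : ∀ z u → z *ℂ u ∼ u *ℂ z
  comm z u = ≈ℂ⇒∼ {z *ℂ u} {u *ℂ z} (*ℂ-comm z u)

-- The product is the positive real `normSq z`.
*-conj∼1 : ∀ z → 0ℝ < normSq z → z *ℂ conj z ∼ 1ℂ
*-conj∼1 z@(a +i b) 0<∣z∣² = 1ℝ , normSq z , 0<1 , 0<∣z∣² , pointwise⇒≈ℂ {1ℝ • (z *ℂ conj z)} {normSq z • 1ℂ}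
  (λ n → solve 2 (λ a b → con 1ℚ :* (a :* a :+ :- (b :* (:- b))) := (a :* a :+ b :* b) :* con 1ℚ) refl (seq a n) (seq b n))
  (λ n → solve 2 (λ a b → con 1ℚ :* (a :* (:- b) :+ b :* a) := (a :* a :+ b :* b) :* con 0ℚ) refl (seq a n) (seq b n))

-1ℂ : ℂ
-1ℂ = -ℂ 1ℂ

cancel-positive : ∀ {r x y} (p : 0ℝ < r) → r * x ≈ y → x ≈ inv r p * y
cancel-positive {r} {x} {y} p h =
  ≈-trans {x} {1ℝ * x} {r⁻¹ * y} (pointwise⇒≈ {x} {1ℝ * x} λ n → sym (ℚₚ.*-identityˡ (seq x n)))
  (≈-trans {1ℝ * x} {(r * r⁻¹) * x} {r⁻¹ * y}
    (*-cong {1ℝ} {r * r⁻¹} {x} {x} (≈-sym {r * r⁻¹} {1ℝ} (inv-inverse r p)) (≈-refl {x}))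
  (≈-trans {(r * r⁻¹) * x} {r⁻¹ * (r * x)} {r⁻¹ * y}
    (pointwise⇒≈ {(r * r⁻¹) * x} {r⁻¹ * (r * x)} λ n →
      solve 3 (λ r s x → (r :* s) :* x := s :* (r :* x)) refl (seq r n) (seq r⁻¹ n) (seq x n))
    (*-cong {r⁻¹} {r⁻¹} {r * x} {y} (≈-refl {r⁻¹}) h)))
  where r⁻¹ = inv r p

-- From rz = -s follows z = -(s/r), with negative real and vanishing imaginary part.
∼-1⇒ℝ⁻ : ∀ {z} → z ∼ -1ℂ → ℝ⁻ z
∼-1⇒ℝ⁻ {z@(a +i b)} (r , s , 0<r , 0<s , p , q) =
    ≈-neg-pos⇒<0 {a} {r⁻¹ * s}
      (≈-trans {a} {r⁻¹ * (s * re -1ℂ)} { - (r⁻¹ * s)} (cancel-positive {r} {a} {s * re -1ℂ} 0<r p)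
        (pointwise⇒≈ {r⁻¹ * (s * re -1ℂ)} { - (r⁻¹ * s)} λ n →
          solve 2 (λ t s → t :* (s :* (:- con 1ℚ)) := :- (t :* s)) refl (seq r⁻¹ n) (seq s n)))
      (*-pos {r⁻¹} {s} (inv-pos r 0<r) 0<s)
  , ≈-trans {b} {r⁻¹ * (s * im -1ℂ)} {0ℝ} (cancel-positive {r} {b} {s * im -1ℂ} 0<r q)
      (pointwise⇒≈ {r⁻¹ * (s * im -1ℂ)} {0ℝ} λ n →
        solve 2 (λ t s → t :* (s :* (:- con 0ℚ)) := con 0ℚ) refl (seq r⁻¹ n) (seq s n))
  where r⁻¹ = inv r 0<r

1∉ℝ⁻ : ¬ ℝ⁻ 1ℂ
1∉ℝ⁻ ((δ , 0<δ , N , h) , _) = ℚₚ.<-irrefl refl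
  (ℚₚ.<-≤-trans (ℚₚ.+-mono-< (ℚₚ.positive⁻¹ 1ℚ) 0<δ) (h N ℕₚ.≤-refl))

-ℂ-def : ∀ z → -ℂ z ≈ℂ -1ℂ *ℂ z
-ℂ-def z@(a +i b) = pointwise⇒≈ℂ { -ℂ z} { -1ℂ *ℂ z}
  (λ n → solve 2 (λ a b → :- a := (:- con 1ℚ) :* a :+ :- ((:- con 0ℚ) :* b)) refl (seq a n) (seq b n))
  (λ n → solve 2 (λ a b → :- b := (:- con 1ℚ) :* b :+ (:- con 0ℚ) :* a) refl (seq a n) (seq b n))

-1*-1 : -1ℂ *ℂ -1ℂ ∼ 1ℂ
-- Twice negated, 1 computes to 1 on the constant sequences, and `_≈ℂ_` looks only at their terms.
-1*-1 = ≈ℂ⇒∼ { -1ℂ *ℂ -1ℂ} {1ℂ} (≈ℂ-sym { -ℂ -1ℂ} { -1ℂ *ℂ -1ℂ} (-ℂ-def -1ℂ))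

-- Multiplying by rs clears both denominators; each number ends up scaled by the other's
-- denominator, hence the crossed witnesses.
÷-opposite : ∀ z u r s (p : 0ℝ < r) (q : 0ℝ < s) → z ÷ r [ p ] ≈ℂ -ℂ (u ÷ s [ q ]) → z ∼ -1ℂ *ℂ u
÷-opposite z u r s p q (h , k) = ∼-trans {z} { -ℂ u} { -1ℂ *ℂ u}
  (s , r , q , p , clear (re z) (re u) h , clear (im z) (im u) k)
  (≈ℂ⇒∼ { -ℂ u} { -1ℂ *ℂ u} (-ℂ-def u))
  where
  r⁻¹ = inv r p
  s⁻¹ = inv s q
  clear : ∀ x y → x * r⁻¹ ≈ - (y * s⁻¹) → s * x ≈ r * - y
  clear x y h =
    ≈-trans {s * x} {1ℝ * (s * x)} {r * - y}
      (pointwise⇒≈ {s * x} {1ℝ * (s * x)} λ n → sym (ℚₚ.*-identityˡ (seq s n ℚ.* seq x n)))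
    (≈-trans {1ℝ * (s * x)} {(r * r⁻¹) * (s * x)} {r * - y}
      (*-cong {1ℝ} {r * r⁻¹} {s * x} {s * x} (≈-sym {r * r⁻¹} {1ℝ} (inv-inverse r p)) (≈-refl {s * x}))
    (≈-trans {(r * r⁻¹) * (s * x)} {(s * r) * (x * r⁻¹)} {r * - y}
      (pointwise⇒≈ {(r * r⁻¹) * (s * x)} {(s * r) * (x * r⁻¹)} λ n →
        solve 4 (λ r r′ s x → (r :* r′) :* (s :* x) := (s :* r) :* (x :* r′)) refl
          (seq r n) (seq r⁻¹ n) (seq s n) (seq x n))
    (≈-trans {(s * r) * (x * r⁻¹)} {(s * r) * - (y * s⁻¹)} {r * - y}
      (*-cong {s * r} {s * r} {x * r⁻¹} { - (y * s⁻¹)} (≈-refl {s * r}) h)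
    (≈-trans {(s * r) * - (y * s⁻¹)} {(s * s⁻¹) * (r * - y)} {r * - y}
      (pointwise⇒≈ {(s * r) * - (y * s⁻¹)} {(s * s⁻¹) * (r * - y)} λ n →
        solve 4 (λ s s′ r y → (s :* r) :* (:- (y :* s′)) := (s :* s′) :* (r :* (:- y))) refl
          (seq s n) (seq s⁻¹ n) (seq r n) (seq y n))
    (≈-trans {(s * s⁻¹) * (r * - y)} {1ℝ * (r * - y)} {r * - y}
      (*-cong {s * s⁻¹} {1ℝ} {r * - y} {r * - y} (inv-inverse s q) (≈-refl {r * - y}))
      (pointwise⇒≈ {1ℝ * (r * - y)} {r * - y} λ n → ℚₚ.*-identityˡ (seq r n ℚ.* (ℚ.- seq y n))))))))

private
  module ℂ/ℝ⁺ = CommutativeMonoid ℂ/ℝ⁺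

opposite-sym : ∀ x′ x → x′ ∼ -1ℂ *ℂ x → x ∼ -1ℂ *ℂ x′
opposite-sym x′ x h = ℂ/ℝ⁺.sym { -1ℂ *ℂ x′} {x} (begin
  -1ℂ *ℂ x′            ≈⟨ ℂ/ℝ⁺.∙-congˡ { -1ℂ} {x′} { -1ℂ *ℂ x} h ⟩
  -1ℂ *ℂ (-1ℂ *ℂ x)    ≈⟨ ℂ/ℝ⁺.assoc -1ℂ -1ℂ x ⟨
  (-1ℂ *ℂ -1ℂ) *ℂ x    ≈⟨ ℂ/ℝ⁺.∙-congʳ {x} { -1ℂ *ℂ -1ℂ} {1ℂ} -1*-1 ⟩
  1ℂ *ℂ x              ≈⟨ ℂ/ℝ⁺.identityˡ x ⟩
  x                    ∎)
  where open ≈-Reasoning ℂ/ℝ⁺.setoid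

-- Multiplying by `conj x` divides by `x` modulo positive factors, so z = x′/x = -1 there.
opposite-ratio : ∀ x′ x z → 0ℝ < normSq x → x′ ∼ -1ℂ *ℂ x → z *ℂ x ∼ x′ → ℝ⁻ z
opposite-ratio x′ x z 0<∣x∣² h k = ∼-1⇒ℝ⁻ {z} (begin
  z                        ≈⟨ unit z ⟨
  (z *ℂ x) *ℂ conj x       ≈⟨ ℂ/ℝ⁺.∙-congʳ {conj x} {z *ℂ x} { -1ℂ *ℂ x} (ℂ/ℝ⁺.trans {z *ℂ x} {x′} { -1ℂ *ℂ x} k h) ⟩
  (-1ℂ *ℂ x) *ℂ conj x     ≈⟨ unit -1ℂ ⟩
  -1ℂ                      ∎)
  where
  open ≈-Reasoning ℂ/ℝ⁺.setoid
  unit : ∀ y → (y *ℂ x) *ℂ conj x ∼ y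
  unit y = begin
    (y *ℂ x) *ℂ conj x     ≈⟨ ℂ/ℝ⁺.assoc y x (conj x) ⟩
    y *ℂ (x *ℂ conj x)     ≈⟨ ℂ/ℝ⁺.∙-congˡ {y} {x *ℂ conj x} {1ℂ} (*-conj∼1 x 0<∣x∣²) ⟩
    y *ℂ 1ℂ                ≈⟨ ℂ/ℝ⁺.identityʳ y ⟩
    y                      ∎

-- Weights of walks

module _ {n : ℕ} (G : OrientedGraph n) (w : Weighting G) where
  open OrientedGraph G
  open Weighting w

  -- By asymmetry exactly one direction of the edge carries the weight and the other its conjugate.
  entry-inverse : ∀ {u v} → Adj G u v → entry G w u v *ℂ entry G w v u ∼ 1ℂ
  entry-inverse {u} {v} e with u ⟶? v | v ⟶? u
  ... | yes p | yes q = ⊥-elim (⟶-asym p q)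
  ... | yes p | no _ = *-conj∼1 (weight u v) (#0⇒normSq-pos (weight u v) (nonzero p))
  ... | no _ | yes q = ℂ/ℝ⁺.trans {conj (weight v u) *ℂ weight v u} {weight v u *ℂ conj (weight v u)} {1ℂ}
    (ℂ/ℝ⁺.comm (conj (weight v u)) (weight v u))
    (*-conj∼1 (weight v u) (#0⇒normSq-pos (weight v u) (nonzero q)))
  ... | no ¬p | no ¬q = ⊥-elim ([ ¬p , ¬q ]′ e)

  wt-walks : (uni : Unicyclic G) → ∀ {i j} (γ′ γ : Walk G i j) →
    let x′ = wt G w (Walk.route γ′) ; x = wt G w (Walk.route γ)
        z = wt G w (Cycle.traversal (Unicyclic.cycle uni)) in
    x′ ∼ x ⊎ z *ℂ x′ ∼ x ⊎ z *ℂ x ∼ x′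
  wt-walks uni = multiplicative-walks G ℂ/ℝ⁺ (entry G w) entry-inverse uni (wt G w)
    (ℂ/ℝ⁺.refl {1ℂ}) (λ {i} {k} _ γ → ℂ/ℝ⁺.refl {entry G w i k *ℂ wt G w γ})

lemma3p6 : ∀ {n : ℕ} → 2 ≤ n →
    (G : OrientedGraph n) (uni : Unicyclic G) (w : Weighting G) →
    (∀ u v → OrientedGraph._⟶_ G u v → ¬ ℝ⁻ (Weighting.weight w u v)) →
    (i j : Fin n) (γ′ γ : Walk G i j) →
    ¬ ℝ⁻ (wt G w (Cycle.traversal (Unicyclic.cycle uni))) →
    ¬ (wt/∣wt∣ G w (Walk.route γ′) ≈ℂ (-ℂ wt/∣wt∣ G w (Walk.route γ)))
lemma3p6 _ G uni w _ i j γ′ γ z∉ℝ⁻ opposite = case (wt-walks G w uni γ′ γ)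
  where
  ρ′ = Walk.route γ′
  ρ = Walk.route γ
  x′ = wt G w ρ′
  x = wt G w ρ
  z = wt G w (Cycle.traversal (Unicyclic.cycle uni))
  x′∼-x : x′ ∼ -1ℂ *ℂ x
  x′∼-x = ÷-opposite x′ x (∣ x′ ∣) (∣ x ∣) (∣wt∣-pos G w ρ′) (∣wt∣-pos G w ρ) opposite
  case : ¬ (x′ ∼ x ⊎ z *ℂ x′ ∼ x ⊎ z *ℂ x ∼ x′)
  -- The ratio of the weights is 1 modulo positive factors, so `1ℂ` takes the place of `z`.
  case (inj₁ h) = 1∉ℝ⁻ (opposite-ratio x′ x 1ℂ (wt-normSq-pos G w ρ) x′∼-x
    (ℂ/ℝ⁺.trans {1ℂ *ℂ x} {x} {x′} (ℂ/ℝ⁺.identityˡ x) (ℂ/ℝ⁺.sym {x′} {x} h)))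
  -- Here `z` is the inverse ratio; as -1 is its own inverse, the walks can exchange roles.
  case (inj₂ (inj₁ h)) = z∉ℝ⁻ (opposite-ratio x x′ z (wt-normSq-pos G w ρ′) (opposite-sym x′ x x′∼-x) h)
  case (inj₂ (inj₂ h)) = z∉ℝ⁻ (opposite-ratio x′ x z (wt-normSq-pos G w ρ) x′∼-x h)
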